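{- There is an absolute constant $c>0$ such that \[ |\mathcal{S}(x,y)+\mathcal{S}(x,y)|\sim \tfrac12\,\Psi(x,y)^2\qquad(x\to\infty) \] uniformly for $2\leqslant y\leqslant c\log x$; that is, $\sup_{2\leqslant y\leqslant c\log x}\left|\frac{|\mathcal{S}(x,y)+\mathcal{S}(x,y)|}{\frac12\Psi(x,y)^2}-1\right|\to 0$ as $x\to\infty$.
   Context: For real $x\geqslant y\geqslant 2$, $\mathcal{S}(x,y)=\{n\in\mathbb{Z}_{\geqslant 1} : n\leqslant x,\ P^+(n)\leqslant y\}$, where $P^+(n)$ denotes the largest prime factor of an integer $n\geqslant 2$ and $P^+(1)=1$, and $\Psi(x,y)=|\mathcal{S}(x,y)|$. For a set $\mathcal{A}$ of integers, $\mathcal{A}+\mathcal{A}=\{a+a' : a,a'\in\mathcal{A}\}$. $\log$ is the natural logarithm. -}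

module Defs where

open import Data.Nat using (ℕ; zero; suc; _+_; _*_; _⊔_; _≤?_)
open import Data.Nat.Primality using (prime?)
open import Data.Nat.Divisibility using (_∣?_)
open import Data.List using (List; filter; upTo; foldr; length; map; cartesianProductWith; deduplicate)
open import Relation.Nullary.Decidable using (_×-dec_)
import Data.Nat as ℕ

-- P⁺ n : the largest prime factor of n, with P⁺ 1 = 1 (and P⁺ 0 = 1, never used).
-- Computed as the maximum (starting from 1) of the primes p ≤ n with p ∣ n.
P⁺ : ℕ → ℕ
P⁺ n = foldr _⊔_ 1 (filter (λ p → prime? p ×-dec (p ∣? n)) (upTo (suc n)))

-- 𝒮 N Y = { n ∈ ℤ≥1 : n ≤ N , P⁺ n ≤ Y }, as a duplicate-free increasing list.
-- (For real x, y: 𝒮(x,y) = 𝒮 ⌊x⌋ ⌊y⌋.)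
𝒮 : ℕ → ℕ → List ℕ
𝒮 N Y = filter (λ n → P⁺ n ≤? Y) (map suc (upTo N))

Ψ : ℕ → ℕ → ℕ
Ψ N Y = length (𝒮 N Y)

sumset : List ℕ → List ℕ
sumset A = deduplicate ℕ._≟_ (cartesianProductWith _+_ A A)

sumsetSize : ℕ → ℕ → ℕ
sumsetSize N Y = length (sumset (𝒮 N Y))

-- A representation a + b = c + d of smooth numbers is encoded by exponent vectors over the primes
-- up to Y.  If the exponents of a prime p differ in (a, b) and in (c, d), then the valuation of the
-- common sum is the minimum on both sides.  So two exponents, one from each side, agree, and the
-- other two exceed them by at least the smaller of the two differences |a - b|, |c - d| (of exponents).
--
-- * Either the product E of p ^ min(|a - b|, |c - d|) over all p is large.  Then, say, a and c agree modulo a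
--   large smooth number.  By a gap principle there are few such c for given a: numbers that are
--   congruent modulo D stay distinct after multiplication by all smooth numbers below D, and it is
--   enough to know D up to rounding, for which there are few choices.  Now b - d = c - a is fixed
--   and nonzero, and the same gap principle leaves few pairs (b, d) unless b / d has small height.
-- * Or E is small.  Then a is close to b at the primes of a set Z, and c is close to d at the
--   others.  One of the two sets has at least half of the primes, so few pairs (a, b), or few
--   pairs (c, d), arise; in the latter case the sum a + b is known, and the gap principle applies.
--
-- All losses have the form C ^ π(Y), and the savings the form t ^ π(Y) for a scale t subject to
-- Y ^ (π(Y) t ^ 39) < N up to constants.  Chebyshev's bound Y ^ π(Y) ≤ 2 ^ (8 Y) makes a large
-- constant t admissible.

module Submission where

open import Defs
open import Data.Bool using (Bool; true; false; if_then_else_; not)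
import Data.Bool.Properties as Boolₚ
open import Data.Empty using (⊥-elim)
open import Data.Fin using (zero; suc)
open import Data.Fin.Properties using (suc-injective; 0≢1+n)
open import Data.List using (List; []; _∷_; length; map; filter; foldr; upTo; deduplicate; cartesianProduct; cartesianProductWith)
open import Data.List.Membership.Propositional using (_∈_; find)
open import Data.List.Membership.Propositional.Properties
  using ( ∈-map⁺; ∈-map⁻; ∈-filter⁺; ∈-filter⁻; ∈-upTo⁺; ∈-upTo⁻; ∈-length; ∈-deduplicate⁺; ∈-deduplicate⁻
        ; ∈-cartesianProduct⁺; ∈-cartesianProduct⁻; ∈-cartesianProductWith⁺; ∈-cartesianProductWith⁻)
open import Data.List.Properties using (length-map; length-++; length-upTo)
open import Data.List.Relation.Unary.All as All using (All; []; _∷_)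
import Data.List.Relation.Unary.All.Properties as Allₚ
open import Data.List.Relation.Unary.AllPairs using ([]; _∷_)
open import Data.List.Relation.Unary.Any as Any using (here; there)
open import Data.List.Relation.Unary.Unique.DecPropositional.Properties using (deduplicate-!)
open import Data.List.Relation.Unary.Unique.Propositional using (Unique)
import Data.List.Relation.Unary.Unique.Propositional.Properties as Uniq
open import Data.Nat
open import Data.Nat.Combinatorics using (_C_; nCk≡n!/k![n-k]!; k![n∸k]!∣n!; nCk+nC[k+1]≡[n+1]C[k+1])
open import Data.Nat.DivMod using (m≡m%n+[m/n]*n; m%n<n; m/n*n≡m)
open import Data.Nat.Divisibility
open import Data.Nat.ListAction using (product)
open import Data.Nat.Primality using (Prime; prime?; prime[2]; ¬prime[0]; euclidsLemma; prime⇒nonZero; prime⇒nonTrivial; prime⇒irreducible)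
open import Data.Nat.Primality.Factorisation using (factorise; factorisationHasAllPrimeFactors; PrimeFactorisation)
open import Data.Nat.Properties hiding (suc-injective; 0≢1+n)
open import Data.Nat.Tactic.RingSolver using (solve-∀)
open import Data.Product using (Σ; _×_; _,_; proj₁; proj₂; ∃; ∃₂; swap)
open import Data.Product.Properties using () renaming (≡-dec to ×-≟)
open import Data.Sum using (_⊎_; inj₁; inj₂)
open import Data.Unit using (⊤; tt)
open import Data.Vec as Vec using (Vec; []; _∷_; lookup; zipWith; replicate; tabulate; fromList)
open import Data.Vec.Properties
  using (lookup-zipWith; lookup-map; lookup-replicate; lookup∘tabulate; ∷-injective; ≡-dec; zipWith-replicate₁; map-replicate)
open import Function using (_∘_; id; case_of_)
open import Relation.Binary using (DecidableEquality; Tri; tri<; tri≈; tri>)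
open import Relation.Binary.PropositionalEquality
open import Relation.Nullary using (¬_; Dec; yes; no; ¬?)
open import Relation.Nullary.Decidable using (_×-dec_)

-- Counting with weights.

private variable
  X I Z : Set
  k     : ℕ

-- At most n / w elements satisfy P; the weight w avoids the division.
record AtMost {X : Set} (w n : ℕ) (P : X → Set) : Set where
  field bound : ∀ xs → Unique xs → All P xs → length xs * w ≤ n
open AtMost public

atMost-≡ : ∀ {w w′ n n′} {P : X → Set} → w ≡ w′ → n ≡ n′ → AtMost w n P → AtMost w′ n′ P
atMost-≡ refl refl h = h

remove : {x : X} (ys : List X) → x ∈ ys → List X
remove (y ∷ ys) (here _)  = ys
remove (y ∷ ys) (there i) = y ∷ remove ys i

length-remove : {x : X} (ys : List X) (i : x ∈ ys) → length ys ≡ suc (length (remove ys i))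
length-remove (y ∷ ys) (here _)  = refl
length-remove (y ∷ ys) (there i) = cong suc (length-remove ys i)

∈-remove : {x z : X} (ys : List X) (i : x ∈ ys) → z ∈ ys → x ≢ z → z ∈ remove ys i
∈-remove (y ∷ ys) (here p)  (here q)  ne = ⊥-elim (ne (trans p (sym q)))
∈-remove (y ∷ ys) (here p)  (there j) ne = j
∈-remove (y ∷ ys) (there i) (here q)  ne = here q
∈-remove (y ∷ ys) (there i) (there j) ne = there (∈-remove ys i j ne)

unique-⊆⇒length≤ : (xs ys : List X) → Unique xs → (∀ {x} → x ∈ xs → x ∈ ys) → length xs ≤ length ys
unique-⊆⇒length≤ []       ys u            s = z≤n
unique-⊆⇒length≤ (x ∷ xs) ys (x∉ ∷ u) s = subst (suc (length xs) ≤_) (sym (length-remove ys i))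
  (s≤s (unique-⊆⇒length≤ xs (remove ys i) u λ j → ∈-remove ys i (s (there j)) (All.lookup x∉ j)))
  where i = s (here refl)

atMost-⊆ : {P : X → Set} (ys : List X) → (∀ {x} → P x → x ∈ ys) → AtMost 1 (length ys) P
bound (atMost-⊆ ys s) xs u ps = subst (_≤ length ys) (sym (*-identityʳ _))
  (unique-⊆⇒length≤ xs ys u (λ i → s (All.lookup ps i)))

atMost-mono : ∀ {w w′ n n′} {P Q : X → Set} → w′ ≤ w → n ≤ n′ → (∀ {x} → Q x → P x) → AtMost w n P → AtMost w′ n′ Q
bound (atMost-mono w≤ n≤ s h) xs u ps = ≤-trans (*-monoʳ-≤ (length xs) w≤) (≤-trans (bound h xs u (All.map s ps)) n≤)

atMost-subsingleton : {P : X → Set} → (∀ {x y} → P x → P y → x ≡ y) → AtMost 1 1 P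
bound (atMost-subsingleton s) [] u ps = z≤n
bound (atMost-subsingleton s) (x ∷ []) u ps = ≤-refl
bound (atMost-subsingleton s) (x ∷ y ∷ xs) ((x≢y ∷ _) ∷ u) (p ∷ q ∷ ps) = ⊥-elim (x≢y (s p q))

atMost-scale : ∀ {w n} {P : X → Set} c → AtMost w n P → AtMost (c * w) (c * n) P
bound (atMost-scale {w = w} {n} c h) xs u ps = begin
  length xs * (c * w) ≡⟨ *-assoc (length xs) c w ⟨
  length xs * c * w   ≡⟨ cong (_* w) (*-comm (length xs) c) ⟩
  c * length xs * w   ≡⟨ *-assoc c _ w ⟩
  c * (length xs * w) ≤⟨ *-monoʳ-≤ c (bound h xs u ps) ⟩
  c * n ∎
  where open ≤-Reasoning

atMost-cancel : ∀ {w n} {P : X → Set} c → .{{NonZero c}} → AtMost (c * w) (c * n) P → AtMost w n P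
bound (atMost-cancel {w = w} {n} c h) xs u ps = *-cancelˡ-≤ c (begin
  c * (length xs * w) ≡⟨ *-assoc c _ w ⟨
  c * length xs * w   ≡⟨ cong (_* w) (*-comm (length xs) c) ⟨
  length xs * c * w   ≡⟨ *-assoc (length xs) c w ⟩
  length xs * (c * w) ≤⟨ bound h xs u ps ⟩
  c * n ∎)
  where open ≤-Reasoning

split : {P Q : X → Set} (xs : List X) → Unique xs → All (λ x → P x ⊎ Q x) xs →
        ∃₂ λ ys zs → Unique ys × Unique zs × All P ys × All Q zs × length xs ≡ length ys + length zs
                     × (∀ {x} → x ∈ ys → x ∈ xs) × (∀ {x} → x ∈ zs → x ∈ xs)
split [] [] [] = [] , [] , [] , [] , [] , [] , refl , id , id
split (x ∷ xs) (x∉ ∷ u) (p ∷ ps) with split xs u ps | p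
... | ys , zs , uy , uz , py , pz , e , sy , sz | inj₁ q =
  x ∷ ys , zs , All.tabulate (λ i → All.lookup x∉ (sy i)) ∷ uy , uz , q ∷ py , pz , cong suc e ,
  (λ { (here r) → here r ; (there i) → there (sy i) }) , there ∘ sz
... | ys , zs , uy , uz , py , pz , e , sy , sz | inj₂ q =
  ys , x ∷ zs , uy , All.tabulate (λ i → All.lookup x∉ (sz i)) ∷ uz , py , q ∷ pz ,
  trans (cong suc e) (sym (+-suc (length ys) (length zs))) ,
  there ∘ sy , (λ { (here r) → here r ; (there i) → there (sz i) })

atMost-⊎ : ∀ {w m n} {P Q : X → Set} → AtMost w m P → AtMost w n Q → AtMost w (m + n) (λ x → P x ⊎ Q x)
bound (atMost-⊎ {w = w} hP hQ) xs u ps with split xs u ps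
... | ys , zs , uy , uz , py , pz , e , _ , _ rewrite e | *-distribʳ-+ w (length ys) (length zs) =
  +-mono-≤ (bound hP ys uy py) (bound hQ zs uz pz)

length-filter-split : {P : X → Set} (P? : ∀ x → Dec (P x)) (xs : List X) →
  length xs ≡ length (filter P? xs) + length (filter (¬? ∘ P?) xs)
length-filter-split P? [] = refl
length-filter-split P? (x ∷ xs) with P? x
... | yes p = cong suc (length-filter-split P? xs)
... | no ¬p = trans (cong suc (length-filter-split P? xs)) (sym (+-suc (length (filter P? xs)) _))

module _ {I : Set} (_≟_ : DecidableEquality I) where

  -- Induction on the tags, removing one fibre at a time. Distinctness is asked of the second
  -- components, because an element may lie in several classes and its tag is only a choice.
  fibres-≤ : ∀ {w n} {J : I → Set} {R : I → X → Set} → (∀ i → J i → AtMost w n (R i)) →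
    (is : List I) → All J is → (zs : List (I × X)) → Unique (map proj₂ zs) →
    All (λ z → proj₁ z ∈ is × R (proj₁ z) (proj₂ z)) zs → length zs * w ≤ length is * n
  fibres-≤ h [] js [] u ps = z≤n
  fibres-≤ h [] js (z ∷ zs) u ((() , _) ∷ ps)
  fibres-≤ {X = X} {w = w} {n} {J} {R} h (i ∷ is) (j ∷ js) zs u ps = begin
    length zs * w
      ≡⟨ cong (_* w) (length-filter-split D zs) ⟩
    (length ys + length ys′) * w
      ≡⟨ *-distribʳ-+ w (length ys) _ ⟩
    length ys * w + length ys′ * w
      ≡⟨ cong (λ l → l * w + length ys′ * w) (length-map proj₂ ys) ⟨
    length (map proj₂ ys) * w + length ys′ * w
      ≤⟨ +-mono-≤ (bound (h i j) (map proj₂ ys) (unique-filter D) ys-R)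
                  (fibres-≤ h is js ys′ (unique-filter (¬? ∘ D)) ys′-R) ⟩
    n + length is * n ∎
    where
    open ≤-Reasoning
    D : (z : I × X) → Dec (i ≡ proj₁ z)
    D z = i ≟ proj₁ z
    ys = filter D zs
    ys′ = filter (¬? ∘ D) zs
    unique-filter : {P : I × X → Set} (P? : ∀ z → Dec (P z)) → Unique (map proj₂ (filter P? zs))
    unique-filter P? = go zs u
      where
      go : ∀ ws → Unique (map proj₂ ws) → Unique (map proj₂ (filter P? ws))
      go [] [] = []
      go (z ∷ ws) (z∉ ∷ v) with P? z
      ... | yes _ = Allₚ.map⁺ (Allₚ.filter⁺ P? (Allₚ.map⁻ z∉)) ∷ go ws v
      ... | no _ = go ws v
    ys-R : All (R i) (map proj₂ ys)
    ys-R = Allₚ.map⁺ (All.tabulate λ {z} z∈ → let z∈zs , e = ∈-filter⁻ D z∈ in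
      subst (λ k → R k (proj₂ z)) (sym e) (proj₂ (All.lookup ps z∈zs)))
    ys′-R : All (λ z → proj₁ z ∈ is × R (proj₁ z) (proj₂ z)) ys′
    ys′-R = All.tabulate λ {z} z∈ → let z∈zs , ne = ∈-filter⁻ (¬? ∘ D) z∈ ; (k∈ , r) = All.lookup ps z∈zs in
      (case k∈ of λ { (here e) → ⊥-elim (ne (sym e)) ; (there k∈′) → k∈′ }) , r

  -- A union bound. Every element is tagged with one class that contains it; the distinct tags
  -- satisfy `J` and are counted first, then the fibres.
  atMost-cover : ∀ {w₁ w₂ n₁ n₂} {J : I → Set} {R : I → X → Set} {P : X → Set} →
    AtMost w₁ n₁ J → (∀ i → J i → AtMost w₂ n₂ (R i)) → (∀ {x} → P x → ∃ λ i → J i × R i x) →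
    AtMost (w₁ * w₂) (n₁ * n₂) P
  bound (atMost-cover {X = X} {w₁ = w₁} {w₂} {n₁} {n₂} {J} {R} {P} hJ hR c) xs u ps = begin
    length xs * (w₁ * w₂)
      ≡⟨ cong (length xs *_) (*-comm w₁ w₂) ⟩
    length xs * (w₂ * w₁)
      ≡⟨ *-assoc (length xs) w₂ w₁ ⟨
    length xs * w₂ * w₁
      ≡⟨ cong (λ l → l * w₂ * w₁) (sym (trans (sym (length-map proj₂ zs)) (cong length zs-xs))) ⟩
    length zs * w₂ * w₁
      ≤⟨ *-monoˡ-≤ w₁ (fibres-≤ hR is is-J zs (subst Unique (sym zs-xs) u) zs-ok) ⟩
    length is * n₂ * w₁
      ≡⟨ *-assoc (length is) n₂ w₁ ⟩
    length is * (n₂ * w₁)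
      ≡⟨ cong (length is *_) (*-comm n₂ w₁) ⟩
    length is * (w₁ * n₂)
      ≡⟨ *-assoc (length is) w₁ n₂ ⟨
    length is * w₁ * n₂
      ≤⟨ *-monoˡ-≤ n₂ (bound hJ is (deduplicate-! _≟_ (map proj₁ zs)) is-J) ⟩
    n₁ * n₂ ∎
    where
    open ≤-Reasoning
    tag : ∀ ys → All P ys → List (I × X)
    tag [] [] = []
    tag (y ∷ ys) (q ∷ qs) = (proj₁ (c q) , y) ∷ tag ys qs
    tag-proj₂ : ∀ ys qs → map proj₂ (tag ys qs) ≡ ys
    tag-proj₂ [] [] = refl
    tag-proj₂ (y ∷ ys) (q ∷ qs) = cong (y ∷_) (tag-proj₂ ys qs)
    tag-ok : ∀ ys qs → All (λ z → J (proj₁ z) × R (proj₁ z) (proj₂ z)) (tag ys qs)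
    tag-ok [] [] = []
    tag-ok (y ∷ ys) (q ∷ qs) = proj₂ (c q) ∷ tag-ok ys qs
    zs = tag xs ps
    zs-xs = tag-proj₂ xs ps
    is = deduplicate _≟_ (map proj₁ zs)
    is-J : All J is
    is-J = All.tabulate λ i∈ → case ∈-map⁻ proj₁ (∈-deduplicate⁻ _≟_ (map proj₁ zs) i∈) of λ
      { (z , z∈ , refl) → proj₁ (All.lookup (tag-ok xs ps) z∈) }
    zs-ok : All (λ z → proj₁ z ∈ is × R (proj₁ z) (proj₂ z)) zs
    zs-ok = All.tabulate λ z∈ → ∈-deduplicate⁺ _≟_ (∈-map⁺ proj₁ z∈) , proj₂ (All.lookup (tag-ok xs ps) z∈)

  -- Transport of a bound along a decoding: `R i x` reads `x` off `i`, so every class of the cover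
  -- is a single point.
  atMost-inj : ∀ {w n} {J : I → Set} {P : X → Set} (R : I → X → Set) → AtMost w n J →
    (∀ {x} → P x → ∃ λ i → J i × R i x) → (∀ {i x y} → R i x → R i y → x ≡ y) → AtMost w n P
  atMost-inj {w = w} {n} R hJ c s = atMost-≡ (*-identityʳ w) (*-identityʳ n)
    (atMost-cover {R = R} hJ (λ i _ → atMost-subsingleton s) c)

unique-map : {P : X → Set} (f : X → Z) → (∀ {x y} → P x → P y → f x ≡ f y → x ≡ y) →
  ∀ xs → Unique xs → All P xs → Unique (map f xs)
unique-map f s [] [] [] = []
unique-map f s (x ∷ xs) (x∉ ∷ u) (p ∷ ps) =
  Allₚ.map⁺ (All.tabulate λ i e → All.lookup x∉ i (s p (All.lookup ps i) e)) ∷ unique-map f s xs u ps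

length-cartesianProductWith : {W : Set} (f : X → Z → W) (xs : List X) (ys : List Z) →
  length (cartesianProductWith f xs ys) ≡ length xs * length ys
length-cartesianProductWith f [] ys = refl
length-cartesianProductWith f (x ∷ xs) ys = trans (length-++ (map (f x) ys))
  (cong₂ _+_ (length-map (f x) ys) (length-cartesianProductWith f xs ys))

-- The products `op x b` are all different, so a lower bound for the number of factors `b` becomes a
-- saving in the count of the `x`. Every saving in the gap principle and in `atMost-spread` arises
-- in this way.
atMost-product : ∀ {w n} {P : X → Set} {S : Z → Set} (op : X → I → Z) (bs : List I) → Unique bs →
  (∀ {x b} → P x → b ∈ bs → S (op x b)) →
  (∀ {x x′ b b′} → P x → P x′ → b ∈ bs → b′ ∈ bs → op x b ≡ op x′ b′ → x ≡ x′ × b ≡ b′) →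
  AtMost w n S → AtMost (length bs * w) n P
bound (atMost-product {X = X} {Z = Z} {I = I} {w = w} {n} {P} {S} op bs ub s inj h) xs u ps = begin
  length xs * (length bs * w)   ≡⟨ *-assoc (length xs) _ w ⟨
  length xs * length bs * w     ≡⟨ cong (_* w) (length-cartesianProductWith _,_ xs bs) ⟨
  length zs * w                 ≡⟨ cong (_* w) (length-map f zs) ⟨
  length (map f zs) * w         ≤⟨ bound h (map f zs) (unique-map f f-inj zs (Uniq.cartesianProduct⁺ u ub) zs-ok)
                                    (Allₚ.map⁺ (All.map (λ { (p , b∈) → s p b∈ }) zs-ok)) ⟩
  n ∎
  where
  open ≤-Reasoning
  zs = cartesianProduct xs bs
  f = λ z → op (proj₁ z) (proj₂ z)
  zs-ok : All (λ z → P (proj₁ z) × proj₂ z ∈ bs) zs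
  zs-ok = All.tabulate λ {z} z∈ → let (x∈ , b∈) = ∈-cartesianProduct⁻ xs bs z∈ in All.lookup ps x∈ , b∈
  f-inj : ∀ {y z} → P (proj₁ y) × proj₂ y ∈ bs → P (proj₁ z) × proj₂ z ∈ bs → f y ≡ f z → y ≡ z
  f-inj (p , b∈) (p′ , b∈′) e = let (e₁ , e₂) = inj p p′ b∈ b∈′ e in cong₂ _,_ e₁ e₂

atMost-pair : ∀ {w n w′ n′} → DecidableEquality I → {J : I → Set} {K : I → Z → Set} →
  AtMost w n J → (∀ i → J i → AtMost w′ n′ (K i)) → AtMost (w * w′) (n * n′) (λ (z : I × Z) → J (proj₁ z) × K (proj₁ z) (proj₂ z))
atMost-pair {I = I} {Z = Z} _≟_ {J} {K} hJ hK = atMost-cover _≟_ {R = λ i z → proj₁ z ≡ i × K i (proj₂ z)} hJ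
  (λ i j → fibre i (hK i j)) (λ { {i , z} (j , k) → i , j , refl , k })
  where
  fibre : ∀ {w n} i → AtMost w n (K i) → AtMost w n (λ (z : I × Z) → proj₁ z ≡ i × K i (proj₂ z))
  bound (fibre i h) xs u ps = subst (λ l → l * _ ≤ _) (length-map proj₂ xs)
    (bound h (map proj₂ xs) (unique-map proj₂ (λ { (refl , _) (refl , _) refl → refl }) xs u ps)
      (Allₚ.map⁺ (All.map proj₂ ps)))

-- Exponent vectors and valuations

^-distribʳ-* : ∀ s x y → (x * y) ^ s ≡ x ^ s * y ^ s
^-distribʳ-* zero x y = refl
^-distribʳ-* (suc s) x y = trans (cong (x * y *_) (^-distribʳ-* s x y)) (lem x y (x ^ s) (y ^ s))
  where
  lem : ∀ a b c d → a * b * (c * d) ≡ a * c * (b * d)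
  lem = solve-∀

vec-ext : ∀ {A : Set} (a b : Vec A k) → (∀ i → lookup a i ≡ lookup b i) → a ≡ b
vec-ext [] [] h = refl
vec-ext (x ∷ a) (y ∷ b) h = cong₂ _∷_ (h zero) (vec-ext a b (h ∘ suc))

infixl 6 _⊞_ _⊟_
infixl 7 _⊠_

_⊞_ _⊟_ _⊠_ : Vec ℕ k → Vec ℕ k → Vec ℕ k
_⊞_ = zipWith _+_
_⊟_ = zipWith ∣_-_∣
_⊠_ = zipWith _*_

⊞-cancelʳ : (a b c : Vec ℕ k) → a ⊞ c ≡ b ⊞ c → a ≡ b
⊞-cancelʳ [] [] [] e = refl
⊞-cancelʳ (x ∷ a) (y ∷ b) (z ∷ c) e = let (e₁ , e₂) = ∷-injective e in
  cong₂ _∷_ (+-cancelʳ-≡ z x y e₁) (⊞-cancelʳ a b c e₂)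

vprod : Vec ℕ k → ℕ
vprod [] = 1
vprod (x ∷ u) = x * vprod u

vsum : Vec ℕ k → ℕ
vsum [] = 0
vsum (x ∷ u) = x + vsum u

vprod-replicate : ∀ k s → vprod (replicate k s) ≡ s ^ k
vprod-replicate zero s = refl
vprod-replicate (suc k) s = cong (s *_) (vprod-replicate k s)

-- The possible remainders of a coordinatewise division by `u`.
box : Vec ℕ k → List (Vec ℕ k)
box [] = [] ∷ []
box (x ∷ u) = cartesianProductWith _∷_ (upTo x) (box u)

length-box : (u : Vec ℕ k) → length (box u) ≡ vprod u
length-box [] = refl
length-box (x ∷ u) = trans (length-cartesianProductWith _∷_ (upTo x) (box u)) (cong₂ _*_ (length-upTo x) (length-box u))

unique-box : (u : Vec ℕ k) → Unique (box u)
unique-box [] = [] ∷ []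
unique-box (x ∷ u) = Uniq.cartesianProductWith⁺ _∷_ ∷-injective (Uniq.upTo⁺ x) (unique-box u)

∈-box⁺ : (u r : Vec ℕ k) → (∀ i → lookup r i < lookup u i) → r ∈ box u
∈-box⁺ [] [] h = here refl
∈-box⁺ (x ∷ u) (y ∷ r) h = ∈-cartesianProductWith⁺ _∷_ (∈-upTo⁺ (h zero)) (∈-box⁺ u r (h ∘ suc))

∈-box⁻ : (u r : Vec ℕ k) → r ∈ box u → ∀ i → lookup r i < lookup u i
∈-box⁻ (x ∷ u) r r∈ i with ∈-cartesianProductWith⁻ _∷_ (upTo x) (box u) r∈
∈-box⁻ (x ∷ u) r r∈ zero | _ , _ , y∈ , _ , refl = ∈-upTo⁻ y∈
∈-box⁻ (x ∷ u) r r∈ (suc i) | _ , r′ , _ , r′∈ , refl = ∈-box⁻ u r′ r′∈ i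

divMod : (u e : Vec ℕ k) → (∀ i → 1 ≤ lookup u i) → ∃₂ λ m r → r ∈ box u × e ≡ u ⊠ m ⊞ r
divMod [] [] h = [] , [] , here refl , refl
divMod (x ∷ u) (y ∷ e) h with divMod u e (h ∘ suc)
... | m , r , r∈ , eq = y / x ∷ m , y % x ∷ r , ∈-cartesianProductWith⁺ _∷_ (∈-upTo⁺ (m%n<n y x)) r∈ ,
  cong₂ _∷_ (trans (m≡m%n+[m/n]*n y x) (trans (+-comm (y % x) _) (cong (_+ y % x) (*-comm (y / x) x)))) eq
  where instance _ = >-nonZero (h zero)

divMod-unique : ∀ x {m m′ r r′} → r < x → r′ < x → x * m + r ≡ x * m′ + r′ → m ≡ m′ × r ≡ r′
divMod-unique x {m} {m′} {r} {r′} r< r′< e = mm , +-cancelˡ-≡ (x * m) r r′ (trans e (cong (λ z → x * z + r′) (sym mm)))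
  where
  aux : ∀ {m m′ r r′} → r′ < x → x * m + r ≡ x * m′ + r′ → m ≤ m′
  aux {m} {m′} {r} {r′} r′< e = ≮⇒≥ λ m′<m → <-irrefl refl (begin-strict
    x * m′ + r′ <⟨ +-monoʳ-< (x * m′) r′< ⟩
    x * m′ + x  ≡⟨ trans (+-comm (x * m′) x) (sym (*-suc x m′)) ⟩
    x * suc m′  ≤⟨ *-monoʳ-≤ x m′<m ⟩
    x * m       ≤⟨ m≤m+n _ r ⟩
    x * m + r   ≡⟨ e ⟩
    x * m′ + r′ ∎)
    where open ≤-Reasoning
  mm = ≤-antisym (aux {r = r} r′< e) (aux {r = r′} r< (sym e))

⊠⊞-unique : (u m m′ r r′ : Vec ℕ k) → r ∈ box u → r′ ∈ box u → u ⊠ m ⊞ r ≡ u ⊠ m′ ⊞ r′ → m ≡ m′ × r ≡ r′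
⊠⊞-unique u m m′ r r′ r∈ r′∈ e = go u m m′ r r′ (∈-box⁻ u r r∈) (∈-box⁻ u r′ r′∈) e
  where
  go : ∀ {k} (u m m′ r r′ : Vec ℕ k) → (∀ i → lookup r i < lookup u i) → (∀ i → lookup r′ i < lookup u i) →
    u ⊠ m ⊞ r ≡ u ⊠ m′ ⊞ r′ → m ≡ m′ × r ≡ r′
  go [] [] [] [] [] _ _ _ = refl , refl
  go (x ∷ u) (y ∷ m) (y′ ∷ m′) (z ∷ r) (z′ ∷ r′) h h′ e =
    let (e₁ , e₂) = ∷-injective e
        (a₁ , b₁) = divMod-unique x (h zero) (h′ zero) e₁
        (a₂ , b₂) = go u m m′ r r′ (h ∘ suc) (h′ ∘ suc) e₂
    in cong₂ _∷_ a₁ a₂ , cong₂ _∷_ b₁ b₂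

-- Smooth numbers are encoded by exponent vectors over a fixed vector of primes.
ev : Vec ℕ k → Vec ℕ k → ℕ
ev [] [] = 1
ev (p ∷ ps) (e ∷ es) = p ^ e * ev ps es

ev-⊞ : (ps a b : Vec ℕ k) → ev ps (a ⊞ b) ≡ ev ps a * ev ps b
ev-⊞ [] [] [] = refl
ev-⊞ (p ∷ ps) (a ∷ as) (b ∷ bs) = trans (cong₂ _*_ (^-distribˡ-+-* p a b) (ev-⊞ ps as bs)) (lem (p ^ a) _ _ _)
  where
  lem : ∀ a b c d → a * b * (c * d) ≡ a * c * (b * d)
  lem = solve-∀

ev-scale : ∀ s (ps a : Vec ℕ k) → ev ps (Vec.map (s *_) a) ≡ ev ps a ^ s
ev-scale s [] [] = sym (^-zeroˡ s)
ev-scale s (p ∷ ps) (a ∷ as) = begin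
  p ^ (s * a) * ev ps (Vec.map (s *_) as) ≡⟨ cong₂ _*_ (cong (p ^_) (*-comm s a)) (ev-scale s ps as) ⟩
  p ^ (a * s) * ev ps as ^ s          ≡⟨ cong (_* _) (^-*-assoc p a s) ⟨
  (p ^ a) ^ s * ev ps as ^ s          ≡⟨ ^-distribʳ-* s (p ^ a) _ ⟨
  (p ^ a * ev ps as) ^ s ∎
  where open ≡-Reasoning

ev-zero : (ps : Vec ℕ k) → ev ps (replicate k 0) ≡ 1
ev-zero [] = refl
ev-zero (p ∷ ps) = trans (+-identityʳ _) (ev-zero ps)

ev-mono : (ps a b : Vec ℕ k) → (∀ i → 1 ≤ lookup ps i) → (∀ i → lookup a i ≤ lookup b i) → ev ps a ≤ ev ps b
ev-mono [] [] [] h l = ≤-refl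
ev-mono (p ∷ ps) (a ∷ as) (b ∷ bs) h l =
  *-mono-≤ (^-monoʳ-≤ p (l zero)) (ev-mono ps as bs (h ∘ suc) (l ∘ suc))
  where instance _ = >-nonZero (h zero)

1≤ev : (ps a : Vec ℕ k) → (∀ i → 1 ≤ lookup ps i) → 1 ≤ ev ps a
1≤ev [] [] h = ≤-refl
1≤ev (p ∷ ps) (a ∷ as) h = *-mono-≤ (m^n>0 p a) (1≤ev ps as (h ∘ suc))
  where instance _ = >-nonZero (h zero)

ev-≤-pow : ∀ M (ps a : Vec ℕ k) → (∀ i → lookup ps i ^ lookup a i ≤ M) → ev ps a ≤ M ^ k
ev-≤-pow M [] [] h = ≤-refl
ev-≤-pow M (p ∷ ps) (a ∷ as) h = *-mono-≤ (h zero) (ev-≤-pow M ps as (h ∘ suc))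

pow-vsum≤ev : ∀ M (ps h f : Vec ℕ k) → (∀ i → M ≤ lookup ps i ^ lookup h i) → M ^ vsum f ≤ ev ps (h ⊠ f)
pow-vsum≤ev M [] [] [] _ = ≤-refl
pow-vsum≤ev M (p ∷ ps) (h ∷ hs) (f ∷ fs) l = begin
  M ^ (f + vsum fs)              ≡⟨ ^-distribˡ-+-* M f _ ⟩
  M ^ f * M ^ vsum fs            ≤⟨ *-mono-≤ (^-monoˡ-≤ f (l zero)) (pow-vsum≤ev M ps hs fs (l ∘ suc)) ⟩
  (p ^ h) ^ f * ev ps (hs ⊠ fs)  ≡⟨ cong (_* _) (^-*-assoc p h f) ⟩
  p ^ (h * f) * ev ps (hs ⊠ fs) ∎
  where open ≤-Reasoning

prime∣^ : ∀ {p} → Prime p → ∀ m n → p ∣ m ^ n → p ∣ m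
prime∣^ {p} pp m zero d = ⊥-elim (1∤ d)
  where
  1∤ : ¬ (p ∣ 1)
  1∤ d with ∣1⇒≡1 d | prime⇒nonTrivial pp
  ... | refl | ()
prime∣^ pp m (suc n) d with euclidsLemma m (m ^ n) pp d
... | inj₁ x = x
... | inj₂ y = prime∣^ pp m n y

prime∣prime⇒≡ : ∀ {p q} → Prime p → Prime q → p ∣ q → p ≡ q
prime∣prime⇒≡ {p} pp pq d with prime⇒irreducible pq d
... | inj₂ e = e
... | inj₁ refl with prime⇒nonTrivial pp
... | ()

^∣-cancel : ∀ {p} → Prime p → ∀ e {w m} → ¬ (p ∣ w) → p ^ e ∣ w * m → p ^ e ∣ m
^∣-cancel pp zero ¬d d = 1∣ _
^∣-cancel {p} pp (suc e) {w} {m} ¬d d with euclidsLemma w m pp (m*n∣⇒m∣ p (p ^ e) d)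
... | inj₁ x = ⊥-elim (¬d x)
... | inj₂ (divides m′ refl) = subst (p * p ^ e ∣_) (*-comm p m′) (*-monoʳ-∣ p (^∣-cancel pp e {m = m′} ¬d
      (*-cancelˡ-∣ p {{prime⇒nonZero pp}} (subst (p * p ^ e ∣_) (lem w m′ p) d))))
  where
  lem : ∀ a b c → a * (b * c) ≡ c * (a * b)
  lem = solve-∀

^*-unique : ∀ {p} → Prime p → ∀ a b {w w′} → ¬ (p ∣ w) → ¬ (p ∣ w′) → p ^ a * w ≡ p ^ b * w′ → a ≡ b
^*-unique pp zero zero ¬d ¬d′ e = refl
^*-unique {p} pp zero (suc b) {w} {w′} ¬d ¬d′ e =
  ⊥-elim (¬d (subst (p ∣_) (trans (sym e) (*-identityˡ w)) (∣m⇒∣m*n w′ (m∣m*n (p ^ b)))))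
^*-unique {p} pp (suc a) zero {w} {w′} ¬d ¬d′ e =
  ⊥-elim (¬d′ (subst (p ∣_) (trans e (*-identityˡ w′)) (∣m⇒∣m*n w (m∣m*n (p ^ a)))))
^*-unique {p} pp (suc a) (suc b) {w} {w′} ¬d ¬d′ e = cong suc (^*-unique pp a b ¬d ¬d′
  (*-cancelˡ-≡ _ _ p {{prime⇒nonZero pp}} (trans (sym (*-assoc p (p ^ a) w)) (trans e (*-assoc p (p ^ b) w′)))))

prime∤ev : ∀ {q} → Prime q → (ps e : Vec ℕ k) → (∀ i → Prime (lookup ps i)) → (∀ i → q ≢ lookup ps i) → ¬ (q ∣ ev ps e)
prime∤ev pq [] [] pr ne d with ∣1⇒≡1 d | prime⇒nonTrivial pq
... | refl | ()
prime∤ev pq (p ∷ ps) (e ∷ es) pr ne d with euclidsLemma (p ^ e) (ev ps es) pq d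
... | inj₁ x = ne zero (prime∣prime⇒≡ pq (pr zero) (prime∣^ pq p e x))
... | inj₂ y = prime∤ev pq ps es (pr ∘ suc) (ne ∘ suc) y

-- Exhibits `lookup e i` as the exact valuation at the `i`-th prime.
ev-split : (ps e : Vec ℕ k) → (∀ i → Prime (lookup ps i)) → (∀ i j → lookup ps i ≡ lookup ps j → i ≡ j) →
  ∀ i → ∃ λ w → ev ps e ≡ lookup ps i ^ lookup e i * w × ¬ (lookup ps i ∣ w)
ev-split (p ∷ ps) (e ∷ es) pr inj zero = ev ps es , refl ,
  prime∤ev (pr zero) ps es (pr ∘ suc) (λ i eq → 0≢1+n (inj zero (suc i) eq))
ev-split (p ∷ ps) (e ∷ es) pr inj (suc i) with ev-split ps es (pr ∘ suc) (λ i j eq → suc-injective (inj (suc i) (suc j) eq)) i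
... | w , eq , ¬d = p ^ e * w , trans (cong (p ^ e *_) eq) (lem (p ^ e) (lookup ps i ^ lookup es i) w) , ¬d′
  where
  lem : ∀ a b c → a * (b * c) ≡ b * (a * c)
  lem = solve-∀
  ¬d′ : ¬ (lookup ps i ∣ p ^ e * w)
  ¬d′ d with euclidsLemma (p ^ e) w (pr (suc i)) d
  ... | inj₂ y = ¬d y
  ... | inj₁ x with inj (suc i) zero (prime∣prime⇒≡ (pr (suc i)) (pr zero) (prime∣^ (pr (suc i)) p e x))
  ... | ()

-- Powers of distinct primes are coprime: the next prime power is prime to the part already divided
-- out, so it divides the quotient.
ev-∣ : (ps e : Vec ℕ k) → (∀ i → Prime (lookup ps i)) → (∀ i j → lookup ps i ≡ lookup ps j → i ≡ j) →
  ∀ {n} → (∀ i → lookup ps i ^ lookup e i ∣ n) → ev ps e ∣ n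
ev-∣ [] [] pr inj h = 1∣ _
ev-∣ (p ∷ ps) (e ∷ es) pr inj h with ev-∣ ps es (pr ∘ suc) (λ i j eq → suc-injective (inj (suc i) (suc j) eq)) (h ∘ suc)
... | divides m refl = subst (p ^ e * ev ps es ∣_) (*-comm (ev ps es) m) (subst (_∣ ev ps es * m) (*-comm (ev ps es) (p ^ e))
  (*-monoʳ-∣ (ev ps es) (^∣-cancel (pr zero) e {w = ev ps es}
    (prime∤ev (pr zero) ps es (pr ∘ suc) (λ i eq → 0≢1+n (inj zero (suc i) eq)))
    (subst (p ^ e ∣_) (*-comm m (ev ps es)) (h zero)))))

ev-injective : (ps : Vec ℕ k) → (∀ i → Prime (lookup ps i)) → (∀ i j → lookup ps i ≡ lookup ps j → i ≡ j) →
  ∀ a b → ev ps a ≡ ev ps b → a ≡ b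
ev-injective ps pr inj a b eq = vec-ext a b λ i →
  let (w , e , d) = ev-split ps a pr inj i ; (w′ , e′ , d′) = ev-split ps b pr inj i in
  ^*-unique (pr i) (lookup a i) (lookup b i) d d′ (trans (sym e) (trans eq e′))

-- Counting pairs of close exponent vectors

^-cancelʳ-≤ : ∀ s {a b} → 1 ≤ s → a ^ s ≤ b ^ s → a ≤ b
^-cancelʳ-≤ s 1≤s h = ≮⇒≥ λ b<a → <-irrefl refl (<-≤-trans (^-monoˡ-< s b<a) h)
  where instance _ = >-nonZero 1≤s

_≟ᵛ_ : DecidableEquality (Vec ℕ k)
_≟ᵛ_ = ≡-dec _≟_

allVec : {A : Set} → List A → ∀ k → List (Vec A k)
allVec xs zero = [] ∷ []
allVec xs (suc k) = cartesianProductWith _∷_ xs (allVec xs k)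

length-allVec : {A : Set} (xs : List A) → ∀ k → length (allVec xs k) ≡ length xs ^ k
length-allVec xs zero = refl
length-allVec xs (suc k) = trans (length-cartesianProductWith _∷_ xs (allVec xs k)) (cong (length xs *_) (length-allVec xs k))

∈-allVec : {A : Set} (xs : List A) → (∀ x → x ∈ xs) → (v : Vec A k) → v ∈ allVec xs k
∈-allVec xs h [] = here refl
∈-allVec xs h (x ∷ v) = ∈-cartesianProductWith⁺ _∷_ (h x) (∈-allVec xs h v)

atMost-allVec : {A : Set} (xs : List A) → (∀ x → x ∈ xs) → AtMost 1 (length xs ^ k) (λ (_ : Vec A k) → ⊤)
atMost-allVec {k} xs h = atMost-≡ refl (length-allVec xs k) (atMost-⊆ (allVec xs k) (λ {v} _ → ∈-allVec xs h v))

-- A code records whether a coordinate is close, and the sign of the difference.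
Code : Set
Code = Bool × Bool

codes : List Code
codes = (true , true) ∷ (true , false) ∷ (false , true) ∷ (false , false) ∷ []

∈-codes : ∀ c → c ∈ codes
∈-codes (true , true) = here refl
∈-codes (true , false) = there (here refl)
∈-codes (false , true) = there (there (here refl))
∈-codes (false , false) = there (there (there (here refl)))

∈-bools : ∀ b → b ∈ (true ∷ false ∷ [])
∈-bools true = here refl
∈-bools false = there (here refl)

_≟ᶜ_ : DecidableEquality (Vec ℕ k × Vec Code k)
_≟ᶜ_ = ×-≟ _≟ᵛ_ (≡-dec (×-≟ Boolₚ._≟_ Boolₚ._≟_))

_≟ˢ_ : DecidableEquality (Vec Bool k)
_≟ˢ_ = ≡-dec Boolₚ._≟_

sel : ℕ → Bool → ℕ
sel q true = q
sel q false = 1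

sel≤ : ∀ {q} → 1 ≤ q → ∀ z → sel q z ≤ q
sel≤ h true = ≤-refl
sel≤ h false = h

1≤sel : ∀ {q} → 1 ≤ q → ∀ z → 1 ≤ sel q z
1≤sel h true = h
1≤sel h false = ≤-refl

mask : Vec Bool k → Vec ℕ k → Vec ℕ k
mask = zipWith (λ z x → if z then x else 0)

signs : Vec ℕ k → Vec ℕ k → Vec Bool k
signs = zipWith _≤ᵇ_

≤ᵇ-cases : ∀ x y → ((x ≤ᵇ y) ≡ true × x ≤ y) ⊎ ((x ≤ᵇ y) ≡ false × y ≤ x)
≤ᵇ-cases x y with x ≤ᵇ y | ≤ᵇ⇒≤ x y | ≤⇒≤ᵇ {x} {y}
... | true  | h | _ = inj₁ (refl , h tt)
... | false | _ | h = inj₂ (refl , ≰⇒≥ h)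

-- When `a` is known, a coordinate of `b` close to that of `a` is cheaper to store as a distance;
-- its sign is kept in the code.
encode : Vec Bool k → Vec ℕ k → Vec ℕ k → Vec ℕ k
encode [] [] [] = []
encode (z ∷ zs) (x ∷ a) (y ∷ b) = (if z then ∣ x - y ∣ else y) ∷ encode zs a b

decode₁ : Bool → Bool → ℕ → ℕ → ℕ
decode₁ true true x v = x + v
decode₁ true false x v = x ∸ v
decode₁ false _ x v = v

decode : Vec Code k → Vec ℕ k → Vec ℕ k → Vec ℕ k
decode [] [] [] = []
decode ((z , s) ∷ τ) (x ∷ a) (v ∷ vs) = decode₁ z s x v ∷ decode τ a vs

decode-encode : (z : Vec Bool k) (a b : Vec ℕ k) → decode (zipWith _,_ z (signs a b)) a (encode z a b) ≡ b
decode-encode [] [] [] = refl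
decode-encode (true ∷ z) (x ∷ a) (y ∷ b) with ≤ᵇ-cases x y
... | inj₁ (eq , x≤y) rewrite eq =
  cong₂ _∷_ (trans (cong (x +_) (m≤n⇒∣m-n∣≡n∸m x≤y)) (m+[n∸m]≡n x≤y)) (decode-encode z a b)
... | inj₂ (eq , y≤x) rewrite eq =
  cong₂ _∷_ (trans (cong (x ∸_) (m≤n⇒∣n-m∣≡n∸m y≤x)) (m∸[m∸n]≡n y≤x)) (decode-encode z a b)
decode-encode (false ∷ z) (x ∷ a) (y ∷ b) = cong (y ∷_) (decode-encode z a b)

proj₁-zip : (z s : Vec Bool k) → Vec.map proj₁ (zipWith _,_ z s) ≡ z
proj₁-zip [] [] = refl
proj₁-zip (x ∷ z) (y ∷ s) = cong (x ∷_) (proj₁-zip z s)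

-- The stored vector survives a stretch by `q` on the close coordinates: the price is the `q`-th
-- power of the masked distance, which is assumed small, times `b` itself.
encode-bound : ∀ q (z : Vec Bool k) (a b : Vec ℕ k) → ∀ i →
  lookup (Vec.map (sel q) z ⊠ encode z a b) i ≤ lookup (Vec.map (q *_) (mask z (a ⊟ b)) ⊞ b) i
encode-bound q (true ∷ z) (x ∷ a) (y ∷ b) zero = m≤m+n _ y
encode-bound q (false ∷ z) (x ∷ a) (y ∷ b) zero = subst₂ _≤_ (sym (*-identityˡ y)) (cong (_+ y) (sym (*-zeroʳ q))) ≤-refl
encode-bound q (z ∷ zs) (x ∷ a) (y ∷ b) (suc i) = encode-bound q zs a b i

-- Distances together with signs determine the signed difference of exponents, that is, the fraction
-- of the two numbers. The conclusion is the cross-multiplied form.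
same-difference : (a b a′ b′ : Vec ℕ k) → a ⊟ b ≡ a′ ⊟ b′ → signs a b ≡ signs a′ b′ → a ⊞ b′ ≡ a′ ⊞ b
same-difference [] [] [] [] _ _ = refl
same-difference (x ∷ a) (y ∷ b) (x′ ∷ a′) (y′ ∷ b′) e s =
  let (e₁ , e₂) = ∷-injective e ; (s₁ , s₂) = ∷-injective s in cong₂ _∷_ (coord x y x′ y′ e₁ s₁) (same-difference a b a′ b′ e₂ s₂)
  where
  lem : ∀ a b c → a + (b + c) ≡ b + (a + c)
  lem = solve-∀
  lem′ : ∀ a b c → (a + b) + c ≡ (c + b) + a
  lem′ = solve-∀
  coord : ∀ x y x′ y′ → ∣ x - y ∣ ≡ ∣ x′ - y′ ∣ → (x ≤ᵇ y) ≡ (x′ ≤ᵇ y′) → x + y′ ≡ x′ + y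
  coord x y x′ y′ e s with ≤ᵇ-cases x y | ≤ᵇ-cases x′ y′
  coord x y x′ y′ e s | inj₁ (_ , h) | inj₁ (_ , h′) = begin
    x + y′                 ≡⟨ cong (x +_) (m+[n∸m]≡n h′) ⟨
    x + (x′ + (y′ ∸ x′))   ≡⟨ cong (λ d → x + (x′ + d)) (trans (sym (m≤n⇒∣m-n∣≡n∸m h′)) (trans (sym e) (m≤n⇒∣m-n∣≡n∸m h))) ⟩
    x + (x′ + (y ∸ x))     ≡⟨ lem x x′ _ ⟩
    x′ + (x + (y ∸ x))     ≡⟨ cong (x′ +_) (m+[n∸m]≡n h) ⟩
    x′ + y ∎
    where open ≡-Reasoning
  coord x y x′ y′ e s | inj₂ (_ , g) | inj₂ (_ , g′) = begin
    x + y′                  ≡⟨ cong (_+ y′) (m+[n∸m]≡n g) ⟨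
    (y + (x ∸ y)) + y′      ≡⟨ cong (λ d → y + d + y′) (trans (sym (m≤n⇒∣n-m∣≡n∸m g)) (trans e (m≤n⇒∣n-m∣≡n∸m g′))) ⟩
    (y + (x′ ∸ y′)) + y′    ≡⟨ lem′ y _ y′ ⟩
    (y′ + (x′ ∸ y′)) + y    ≡⟨ cong (_+ y) (m+[n∸m]≡n g′) ⟩
    x′ + y ∎
    where open ≡-Reasoning
  coord x y x′ y′ e s | inj₁ (t , _) | inj₂ (t′ , _) with trans (sym t) (trans s t′)
  ... | ()
  coord x y x′ y′ e s | inj₂ (t , _) | inj₁ (t′ , _) with trans (sym t) (trans s t′)
  ... | ()

atMost-divMod : ∀ {w n} {J P : Vec ℕ k → Set} (u : Vec ℕ k) → (∀ i → 1 ≤ lookup u i) → AtMost w n J →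
  (∀ m r → r ∈ box u → P (u ⊠ m ⊞ r) → J m) → AtMost w (n * vprod u) P
atMost-divMod {w = w} {n} {J} {P} u u≥1 hJ h = atMost-≡ (*-identityʳ w) refl
  (atMost-cover _≟ᵛ_ {R = λ m e → ∃ λ r → r ∈ box u × e ≡ u ⊠ m ⊞ r} hJ
    (λ m _ → atMost-inj _≟ᵛ_ (λ r e → e ≡ u ⊠ m ⊞ r)
      (atMost-≡ refl (length-box u) (atMost-⊆ (box u) id)) id (λ { refl refl → refl }))
    (λ {e} p → let (m , r , r∈ , eq) = divMod u e u≥1 in m , h m r r∈ (subst P eq p) , r , r∈ , eq))

-- An abstract form of the smooth numbers up to `N`: `as` lists their exponent vectors over `k`
-- distinct primes, so that multiplication becomes addition of vectors.
record Setting (k : ℕ) : Set where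
  field
    ps          : Vec ℕ k
    prime       : ∀ i → Prime (lookup ps i)
    distinct    : ∀ i j → lookup ps i ≡ lookup ps j → i ≡ j
    Y N         : ℕ
    ps≤Y        : ∀ i → lookup ps i ≤ Y
    2≤Y         : 2 ≤ Y
    1≤k         : 1 ≤ k
    as          : List (Vec ℕ k)
    as-unique   : Unique as
    as-sound    : All (λ e → ev ps e ≤ N) as
    as-complete : ∀ e → ev ps e ≤ N → e ∈ as

module Smooth {k} (S : Setting k) where
  open Setting S

  1≤Y : 1 ≤ Y
  1≤Y = <⇒≤ 2≤Y

  E : Vec ℕ k → ℕ
  E = ev ps

  InA : Vec ℕ k → Set
  InA e = E e ≤ N

  ψ : ℕ
  ψ = length as

  p≥1 : ∀ i → 1 ≤ lookup ps i
  p≥1 i = >-nonZero⁻¹ _ {{prime⇒nonZero (prime i)}}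

  1≤E : ∀ e → 1 ≤ E e
  1≤E e = 1≤ev ps e p≥1

  E-mono : ∀ {a b} → (∀ i → lookup a i ≤ lookup b i) → E a ≤ E b
  E-mono {a} {b} = ev-mono ps a b p≥1

  E-split : ∀ i e → ∃ λ w → E e ≡ lookup ps i ^ lookup e i * w × ¬ (lookup ps i ∣ w)
  E-split i e = ev-split ps e prime distinct i

  E-inj : ∀ a b → E a ≡ E b → a ≡ b
  E-inj = ev-injective ps prime distinct

  atMost-A : AtMost 1 ψ InA
  atMost-A = atMost-⊆ as (λ {e} → as-complete e)

  E≤⊞ : ∀ a b → E a ≤ E (a ⊞ b)
  E≤⊞ a b = E-mono (λ i → subst (lookup a i ≤_) (sym (lookup-zipWith _+_ i a b)) (m≤m+n _ _))

  E-replicate-⊠ : ∀ s m → E (replicate k s ⊠ m) ≡ E m ^ s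
  E-replicate-⊠ s m = trans (cong E (zipWith-replicate₁ _*_ s m)) (ev-scale s ps m)

  replicate≥1 : ∀ {s} → 1 ≤ s → ∀ i → 1 ≤ lookup (replicate k s) i
  replicate≥1 {s} h i = subst (1 ≤_) (sym (lookup-replicate i s)) h

  -- Division of all exponents by `s` gives a rounded `s`-th root `m`; for each root there are
  -- `s ^ k` remainders.
  atMost-root : ∀ {w n} {P J : Vec ℕ k → Set} s → 1 ≤ s → AtMost w n J →
    (∀ {m e} → E m ^ s ≤ E e → P e → J m) → AtMost w (n * s ^ k) P
  atMost-root {n = n} s 1≤s hJ h = atMost-≡ refl (cong (n *_) (vprod-replicate k s))
    (atMost-divMod (replicate k s) (replicate≥1 1≤s) hJ
      (λ m r _ p → h (subst (_≤ E (replicate k s ⊠ m ⊞ r)) (E-replicate-⊠ s m) (E≤⊞ _ r)) p))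

  atMost-power : ∀ s → 1 ≤ s → AtMost 1 (ψ * s ^ k) (λ e → E e ≤ N ^ s)
  atMost-power s 1≤s = atMost-root s 1≤s atMost-A (λ h p → ^-cancelʳ-≤ s 1≤s (≤-trans h p))

  ∈-box⇒E≤ : ∀ {u r} → r ∈ box u → E r ≤ E u
  ∈-box⇒E≤ {u} {r} r∈ = E-mono (λ i → <⇒≤ (∈-box⁻ u r r∈ i))

  -- Each solution `v` produces `vprod u` vectors `u ⊠ v ⊞ r` with `r` in the box, all distinct.
  -- Their values are at most `N ^ 3`: a factor `N * N` from `v` and a factor `N` from `r`.
  atMost-spread : ∀ u → (∀ i → 1 ≤ lookup u i) → E u ≤ N → AtMost (vprod u) (ψ * 3 ^ k) (λ v → E (u ⊠ v) ≤ N * N)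
  atMost-spread u u≥1 Eu≤N = atMost-≡ (trans (*-identityʳ _) (length-box u)) refl
    (atMost-product (λ v r → u ⊠ v ⊞ r) (box u) (unique-box u)
      (λ {v} {r} h r∈ → begin
        E (u ⊠ v ⊞ r)    ≡⟨ ev-⊞ ps (u ⊠ v) r ⟩
        E (u ⊠ v) * E r  ≤⟨ *-mono-≤ h (≤-trans (∈-box⇒E≤ r∈) Eu≤N) ⟩
        N * N * N        ≡⟨ lem N ⟩
        N ^ 3 ∎)
      (λ {v} {v′} {r} {r′} _ _ r∈ r′∈ → ⊠⊞-unique u v v′ r r′ r∈ r′∈)
      (atMost-power 3 (s≤s z≤n)))
    where
    open ≤-Reasoning
    lem : ∀ a → a * a * a ≡ a * (a * (a * 1))
    lem = solve-∀

  E≤pow : ∀ {q} (u : Vec ℕ k) → (∀ i → lookup u i ≤ q) → E u ≤ Y ^ (k * q)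
  E≤pow {q} u h = begin
    E u          ≤⟨ ev-≤-pow (Y ^ q) ps u (λ i → ≤-trans (^-monoˡ-≤ (lookup u i) (ps≤Y i)) (^-monoʳ-≤ Y (h i))) ⟩
    (Y ^ q) ^ k  ≡⟨ ^-*-assoc Y q k ⟩
    Y ^ (q * k)  ≡⟨ cong (Y ^_) (*-comm q k) ⟩
    Y ^ (k * q) ∎
    where
    open ≤-Reasoning
    instance _ = >-nonZero 1≤Y

  -- `z` selects the coordinates at which `a` is close to `b`. The product compared with `W` is `q`
  -- to the number of these coordinates.
  Near : ℕ → ℕ → Vec ℕ k × Vec ℕ k → Set
  Near q W (a , b) = InA a × InA b × ∃ λ z → W ≤ vprod (Vec.map (sel q) z) × E (mask z (a ⊟ b)) ^ q ≤ N

  lookup-sel : ∀ {q} → 1 ≤ q → (z : Vec Bool k) → ∀ i → 1 ≤ lookup (Vec.map (sel q) z) i × lookup (Vec.map (sel q) z) i ≤ q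
  lookup-sel {q} 1≤q z i = subst (λ x → 1 ≤ x × x ≤ q) (sym (lookup-map i (sel q) z)) (1≤sel 1≤q _ , sel≤ 1≤q _)

  -- Once `a` and one of the `4 ^ k` codes are chosen, `b` is decoded from a vector that stays small
  -- after a stretch by `q` on the close coordinates. `atMost-spread` turns this stretch into the
  -- weight `W`.
  atMost-near : ∀ q W → 1 ≤ q → Y ^ (k * q) ≤ N → AtMost W (ψ * 4 ^ k * (ψ * 3 ^ k)) (Near q W)
  atMost-near q W 1≤q Y≤N = atMost-≡ (*-identityˡ W) refl
    (atMost-cover _≟ᶜ_
      {J = λ { (a , τ) → InA a × W ≤ vprod (Vec.map (sel q) (Vec.map proj₁ τ)) }}
      {R = λ { (a , τ) (a′ , b) → a′ ≡ a × ∃ λ v → E (Vec.map (sel q) (Vec.map proj₁ τ) ⊠ v) ≤ N * N × b ≡ decode τ a v }}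
      (atMost-mono ≤-refl ≤-refl (λ { (p , _) → p , tt }) (atMost-pair _≟ᵛ_ atMost-A (λ _ _ → atMost-allVec codes ∈-codes)))
      (λ { (a , τ) (_ , W≤) → atMost-mono W≤ ≤-refl id
         (atMost-inj _≟ᵛ_ (λ { v (a′ , b) → a′ ≡ a × b ≡ decode τ a v })
           (atMost-spread (Vec.map (sel q) (Vec.map proj₁ τ)) (λ i → proj₁ (lookup-sel 1≤q (Vec.map proj₁ τ) i))
             (≤-trans (E≤pow _ (λ i → proj₂ (lookup-sel 1≤q (Vec.map proj₁ τ) i))) Y≤N))
           (λ { (refl , v , h , e) → v , h , refl , e })
           (λ { (refl , refl) (refl , refl) → refl })) })
      (λ { {a , b} (p , p′ , z , W≤ , h) → (a , zipWith _,_ z (signs a b)) ,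
           (p , subst (λ y → W ≤ vprod (Vec.map (sel q) y)) (sym (proj₁-zip z (signs a b))) W≤) ,
           refl , encode z a b ,
           subst (λ y → E (Vec.map (sel q) y ⊠ encode z a b) ≤ N * N) (sym (proj₁-zip z (signs a b))) (encode≤ a b z p′ h) ,
           sym (decode-encode z a b) }))
    where
    open ≤-Reasoning
    encode≤ : ∀ a b z → InA b → E (mask z (a ⊟ b)) ^ q ≤ N → E (Vec.map (sel q) z ⊠ encode z a b) ≤ N * N
    encode≤ a b z p h = begin
      E (Vec.map (sel q) z ⊠ encode z a b)              ≤⟨ E-mono (encode-bound q z a b) ⟩
      E (Vec.map (q *_) (mask z (a ⊟ b)) ⊞ b)           ≡⟨ ev-⊞ ps (Vec.map (q *_) (mask z (a ⊟ b))) b ⟩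
      E (Vec.map (q *_) (mask z (a ⊟ b))) * E b         ≡⟨ cong (_* E b) (ev-scale q ps _) ⟩
      E (mask z (a ⊟ b)) ^ q * E b                  ≤⟨ *-mono-≤ h p ⟩
      N * N ∎

  -- The equation prescribes the difference of `E b` and `E d` as `γ - α`, without subtraction.
  CloseDifference : ℕ → ℕ → ℕ → Vec ℕ k × Vec ℕ k → Set
  CloseDifference q α γ (b , d) = E b + α ≡ E d + γ × E (b ⊟ d) ^ q ≤ N

  -- Distances and signs fix the fraction of `E b` and `E d`, and two numbers with a given fraction
  -- and a given nonzero difference are determined. It remains to count the signs, `2 ^ k` in
  -- number, and the distances, by `atMost-spread`.
  atMost-closeDifference : ∀ q α γ → 1 ≤ q → Y ^ (k * q) ≤ N → α ≢ γ →
    AtMost (q ^ k) (2 ^ k * (ψ * 3 ^ k)) (CloseDifference q α γ)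
  atMost-closeDifference q α γ 1≤q Y≤N α≢γ = atMost-≡ (*-identityˡ _) refl
    (atMost-cover _≟ˢ_ {R = λ { σ (b , d) → CloseDifference q α γ (b , d) × signs b d ≡ σ }}
      (atMost-allVec (true ∷ false ∷ []) ∈-bools)
      (λ σ _ → atMost-inj _≟ᵛ_ {J = λ v → E (replicate k q ⊠ v) ≤ N * N}
        (λ { v (b , d) → E b + α ≡ E d + γ × signs b d ≡ σ × b ⊟ d ≡ v })
        (atMost-≡ (vprod-replicate k q) refl (atMost-spread (replicate k q) (replicate≥1 1≤q)
          (≤-trans (E≤pow _ (λ i → ≤-reflexive (lookup-replicate i q))) Y≤N)))
        (λ { {b , d} ((e , h) , s) → b ⊟ d , subst (_≤ N * N) (sym (E-replicate-⊠ q _)) (≤-trans h (m≤m*n N N {{>-nonZero 1≤N}})) , e , s , refl })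
        (λ { {v} {b , d} {b′ , d′} (e , s , v≡) (e′ , s′ , v≡′) → unique b d b′ d′ e e′
             (same-difference b d b′ d′ (trans v≡ (sym v≡′)) (trans s (sym s′))) }))
      (λ { {b , d} c → signs b d , tt , c , refl }))
    where
    1≤N = ≤-trans (m^n>0 Y {{>-nonZero 1≤Y}} (k * q)) Y≤N
    lem₁ : ∀ b d d′ α γ → d * d′ + (γ * d′ + α * d) ≡ (d + γ) * d′ + α * d
    lem₁ = solve-∀
    lem₂ : ∀ b b′ d d′ α γ → (b + α) * d′ + α * d ≡ b * d′ + α * d′ + α * d
    lem₂ = solve-∀
    lem₃ : ∀ b′ d d′ α → b′ * d + α * d′ + α * d ≡ (b′ + α) * d + α * d′
    lem₃ = solve-∀
    lem₄ : ∀ d d′ α γ → (d′ + γ) * d + α * d′ ≡ d * d′ + (γ * d + α * d′)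
    lem₄ = solve-∀
    -- Elimination of `b` and `b′` leaves `(γ - α) * (d - d′) = 0`, written without subtraction.
    cross : ∀ b d b′ d′ → b + α ≡ d + γ → b′ + α ≡ d′ + γ → b * d′ ≡ b′ * d → γ * d′ + α * d ≡ γ * d + α * d′
    cross b d b′ d′ e e′ m = +-cancelˡ-≡ (d * d′) _ _ (begin
      d * d′ + (γ * d′ + α * d)      ≡⟨ lem₁ b d d′ α γ ⟩
      (d + γ) * d′ + α * d           ≡⟨ cong (λ x → x * d′ + α * d) e ⟨
      (b + α) * d′ + α * d           ≡⟨ lem₂ b b′ d d′ α γ ⟩
      b * d′ + α * d′ + α * d        ≡⟨ cong (λ x → x + α * d′ + α * d) m ⟩
      b′ * d + α * d′ + α * d        ≡⟨ lem₃ b′ d d′ α ⟩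
      (b′ + α) * d + α * d′          ≡⟨ cong (λ x → x * d + α * d′) e′ ⟩
      (d′ + γ) * d + α * d′          ≡⟨ lem₄ d d′ α γ ⟩
      d * d′ + (γ * d + α * d′) ∎)
      where open ≡-Reasoning
    exch : ∀ α γ d d′ → α < γ → γ * d′ + α * d ≡ γ * d + α * d′ → d ≡ d′
    exch α γ d d′ l e with m≤n⇒∃[o]m+o≡n l
    ... | o , refl = sym (*-cancelˡ-≡ d′ d (suc o) (+-cancelʳ-≡ (α * d′ + α * d) _ _ (trans (lem₅ α o d d′) (trans e (lem₆ α o d d′)))))
      where
      lem₅ : ∀ α o d d′ → suc o * d′ + (α * d′ + α * d) ≡ (suc α + o) * d′ + α * d
      lem₅ = solve-∀
      lem₆ : ∀ α o d d′ → (suc α + o) * d + α * d′ ≡ suc o * d + (α * d′ + α * d)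
      lem₆ = solve-∀
    d-equal : ∀ d d′ → γ * d′ + α * d ≡ γ * d + α * d′ → d ≡ d′
    d-equal d d′ e with <-cmp α γ
    ... | tri< l _ _ = exch α γ d d′ l e
    ... | tri≈ _ eq _ = ⊥-elim (α≢γ eq)
    ... | tri> _ _ l = exch γ α d d′ l (trans (+-comm (α * d′) _) (trans (sym e) (+-comm _ (α * d))))

    unique : ∀ b d b′ d′ → E b + α ≡ E d + γ → E b′ + α ≡ E d′ + γ → b ⊞ d′ ≡ b′ ⊞ d → (b , d) ≡ (b′ , d′)
    unique b d b′ d′ e e′ v = cong₂ _,_ (E-inj b b′ (+-cancelʳ-≡ α _ _ (trans e (trans (cong (_+ γ) D≡) (sym e′))))) (E-inj d d′ D≡)
      where
      D≡ : E d ≡ E d′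
      D≡ = d-equal (E d) (E d′) (cross (E b) (E d) (E b′) (E d′) e e′
        (trans (sym (ev-⊞ ps b d′)) (trans (cong E v) (ev-⊞ ps b′ d))))

-- Congruences and the gap principle

^-cancelˡ-≤ : ∀ {M a b} → 2 ≤ M → M ^ a ≤ M ^ b → a ≤ b
^-cancelˡ-≤ {M} 2≤M h = ≮⇒≥ λ b<a → <-irrefl refl (<-≤-trans (^-monoʳ-< M 2≤M b<a) h)

m<B^m : ∀ B m → 2 ≤ B → m < B ^ m
m<B^m B zero h = s≤s z≤n
m<B^m B (suc m) h = begin-strict
  suc m              ≤⟨ m<B^m B m h ⟩
  B ^ m              <⟨ m<m+n (B ^ m) (m^n>0 B m) ⟩
  B ^ m + B ^ m      ≡⟨ cong (B ^ m +_) (sym (+-identityʳ _)) ⟩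
  2 * B ^ m          ≤⟨ *-monoˡ-≤ (B ^ m) h ⟩
  B ^ suc m ∎
  where
  open ≤-Reasoning
  instance _ = >-nonZero (<⇒≤ h)

floorLog : ∀ B N → 2 ≤ B → B < N → ∃ λ Q → 1 ≤ Q × B ^ Q < N × N ≤ B ^ suc Q
floorLog B N 2≤B B<N = go N 1 ≤-refl (subst (_< N) (sym (*-identityʳ B)) B<N)
  (≤-trans (<⇒≤ (m<B^m B N 2≤B)) (^-monoʳ-≤ B (n≤1+n N)))
  where
  instance _ = >-nonZero (<⇒≤ 2≤B)
  -- `d` is the termination measure: at `d = 0` the last hypothesis contradicts `B ^ j < N`. The
  -- search starts at `j = 1` to ensure `1 ≤ Q`.
  go : ∀ d j → 1 ≤ j → B ^ j < N → N ≤ B ^ (j + d) → ∃ λ Q → 1 ≤ Q × B ^ Q < N × N ≤ B ^ suc Q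
  go zero j 1≤j l h = ⊥-elim (<-irrefl refl (<-≤-trans l (subst (λ x → N ≤ B ^ x) (+-identityʳ j) h)))
  go (suc d) j 1≤j l h with N ≤? B ^ suc j
  ... | yes h′ = j , 1≤j , l , h′
  ... | no ¬h = go d (suc j) (s≤s z≤n) (≰⇒> ¬h) (subst (λ x → N ≤ B ^ x) (+-suc j d) h)

ceilLog : ∀ p M → 2 ≤ p → 2 ≤ M → ∃ λ h → 1 ≤ h × M ≤ p ^ h × p ^ h ≤ p * M
ceilLog p M 2≤p 2≤M with M ≤? p
... | yes M≤p = 1 , ≤-refl , subst (M ≤_) (sym (*-identityʳ p)) M≤p , *-monoʳ-≤ p (<⇒≤ 2≤M)
... | no M≰p with floorLog p M 2≤p (≰⇒> M≰p)
... | Q , 1≤Q , l , h = suc Q , s≤s z≤n , h , *-monoʳ-≤ p (<⇒≤ l)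

-- Recursion as in Pascal's triangle: the first entry is zero and is dropped, or it is positive and
-- is lowered by one.
atMost-vsum : ∀ k s → AtMost 1 (2 ^ (k + s)) (λ (v : Vec ℕ k) → vsum v ≤ s)
atMost-vsum zero s = atMost-mono ≤-refl (m^n>0 2 s) id (atMost-subsingleton λ { {[]} {[]} _ _ → refl })
atMost-vsum (suc k) zero = atMost-mono ≤-refl (m≤m+n (2 ^ (k + 0)) _) id
  (atMost-inj _≟ᵛ_ (λ v v′ → v′ ≡ 0 ∷ v) (atMost-vsum k zero)
    (λ { {zero ∷ v} h → v , h , refl }) (λ { refl refl → refl }))
atMost-vsum (suc k) (suc s) = atMost-mono ≤-refl (≤-reflexive eq) id
  (atMost-mono {P = λ v → Zero v ⊎ Suc v} ≤-refl ≤-refl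
    (λ { {zero ∷ v} h → inj₁ (v , h , refl) ; {suc x ∷ v} (s≤s h) → inj₂ (x ∷ v , h , refl) })
    (atMost-⊎ (atMost-inj _≟ᵛ_ (λ v v′ → v′ ≡ 0 ∷ v) (atMost-vsum k (suc s)) id (λ { refl refl → refl }))
              (atMost-inj _≟ᵛ_ (λ v v′ → v′ ≡ up v) (atMost-vsum (suc k) s) id (λ { refl refl → refl }))))
  where
  up : Vec ℕ (suc k) → Vec ℕ (suc k)
  up (x ∷ v) = suc x ∷ v
  Zero Suc : Vec ℕ (suc k) → Set
  Zero v = ∃ λ v′ → vsum v′ ≤ suc s × v ≡ 0 ∷ v′
  Suc v = ∃ λ v′ → vsum v′ ≤ s × v ≡ up v′
  eq : 2 ^ (k + suc s) + 2 ^ suc (k + s) ≡ 2 ^ (suc k + suc s)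
  eq rewrite +-suc k s = cong (2 ^ suc (k + s) +_) (sym (+-identityʳ _))

vsum-scale≤ : ∀ s (m r : Vec ℕ k) → s * vsum m ≤ vsum (replicate k s ⊠ m ⊞ r)
vsum-scale≤ s [] [] = ≤-reflexive (*-zeroʳ s)
vsum-scale≤ s (x ∷ m) (y ∷ r) = begin
  s * (x + vsum m)       ≡⟨ *-distribˡ-+ s x _ ⟩
  s * x + s * vsum m     ≤⟨ +-mono-≤ (m≤m+n (s * x) y) (vsum-scale≤ s m r) ⟩
  s * x + y + vsum (replicate _ s ⊠ m ⊞ r) ∎
  where open ≤-Reasoning

-- The semiring form of "m ≡ n mod d".
record _≅_[_] (m n d : ℕ) : Set where
  constructor congruent
  field
    u v : ℕ
    eq  : m + d * u ≡ n + d * v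

≅-weaken : ∀ {a b d d′} → d′ ∣ d → a ≅ b [ d ] → a ≅ b [ d′ ]
≅-weaken {a} {b} {d′ = d′} (divides t refl) (congruent u v e) = congruent (t * u) (t * v)
  (trans (cong (a +_) (lem t d′ u)) (trans e (cong (b +_) (sym (lem t d′ v)))))
  where
  lem : ∀ t d u → d * (t * u) ≡ t * d * u
  lem = solve-∀

≅-common : ∀ {c c′ n m d} → (c + n) ≅ m [ d ] → (c′ + n) ≅ m [ d ] → c ≅ c′ [ d ]
≅-common {c} {c′} {n} {m} {d} (congruent u v e) (congruent u′ v′ e′) = congruent (u + v′) (u′ + v) (+-cancelʳ-≡ n _ _ (begin
  c + d * (u + v′) + n        ≡⟨ lem₁ c d u v′ n ⟩
  (c + n + d * u) + d * v′    ≡⟨ cong (_+ d * v′) e ⟩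
  m + d * v + d * v′          ≡⟨ lem₂ m (d * v) (d * v′) ⟩
  (m + d * v′) + d * v        ≡⟨ cong (_+ d * v) e′ ⟨
  (c′ + n + d * u′) + d * v   ≡⟨ lem₁ c′ d u′ v n ⟨
  c′ + d * (u′ + v) + n ∎))
  where
  open ≡-Reasoning
  lem₁ : ∀ c d u v n → c + d * (u + v) + n ≡ (c + n + d * u) + d * v
  lem₁ = solve-∀
  lem₂ : ∀ a b c → a + b + c ≡ a + c + b
  lem₂ = solve-∀

≅-sym : ∀ {a b d} → a ≅ b [ d ] → b ≅ a [ d ]
≅-sym (congruent u v e) = congruent v u (sym e)

≅⇒∣∸ : ∀ {a b d} → a ≤ b → a ≅ b [ d ] → d ∣ b ∸ a
≅⇒∣∸ {a} {b} {d} a≤b (congruent u v e) = ∣m+n∣m⇒∣n (subst (d ∣_) (+-cancelˡ-≡ a _ _ (begin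
  a + d * u                ≡⟨ e ⟩
  b + d * v                ≡⟨ cong (_+ d * v) (m+[n∸m]≡n a≤b) ⟨
  a + (b ∸ a) + d * v      ≡⟨ +-assoc a _ _ ⟩
  a + ((b ∸ a) + d * v)    ≡⟨ cong (a +_) (+-comm (b ∸ a) _) ⟩
  a + (d * v + (b ∸ a)) ∎)) (m∣m*n u)) (m∣m*n v)
  where open ≡-Reasoning

≅⇒∣ : ∀ {a b d} → a ≅ b [ d ] → d ∣ ∣ a - b ∣
≅⇒∣ {a} {b} {d} h with ≤-total a b
... | inj₁ a≤b = subst (d ∣_) (sym (m≤n⇒∣m-n∣≡n∸m a≤b)) (≅⇒∣∸ a≤b h)
... | inj₂ b≤a = subst (d ∣_) (sym (m≤n⇒∣n-m∣≡n∸m b≤a)) (≅⇒∣∸ b≤a (≅-sym h))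

^-∣-mono : ∀ p {a b} → a ≤ b → p ^ a ∣ p ^ b
^-∣-mono p {a} {b} a≤b = divides (p ^ (b ∸ a)) (trans (cong (p ^_) (sym (m∸n+n≡m a≤b))) (^-distribˡ-+-* p (b ∸ a) a))

module _ {p} (pp : Prime p) where

  private instance _ = prime⇒nonZero pp

  -- Modulo `p ^ suc m` the second number vanishes and the first does not.
  ≅⇒valuation≮ : ∀ {m m′ w w′} → ¬ (p ∣ w) → m < m′ → ¬ ((p ^ m * w) ≅ (p ^ m′ * w′) [ p ^ suc m ])
  ≅⇒valuation≮ {m} {m′} {w} {w′} ¬d m<m′ (congruent u v e) = ¬d (*-cancelˡ-∣ (p ^ m) {{m^n≢0 p m}}
    (subst₂ _∣_ (*-comm p (p ^ m)) refl (∣m+n∣m⇒∣n {m = p ^ suc m * u}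
      (subst (p ^ suc m ∣_) (trans (sym e) (+-comm (p ^ m * w) _))
        (∣m∣n⇒∣m+n (∣m⇒∣m*n w′ (^-∣-mono p m<m′)) (m∣m*n v))) (m∣m*n u))))

  -- Cancelling `p ^ m` gives `w ≡ w′` modulo `p ^ g`. Hence `w * b′ ≡ w′ * b′ = w * b`, and `w` can
  -- be cancelled because it is prime to `p`.
  ≅⇒^∣cofactor-difference : ∀ m g {w w′ b b′} → ¬ (p ∣ w) →
    (p ^ m * w) ≅ (p ^ m * w′) [ p ^ (m + g) ] → p ^ m * w * b ≡ p ^ m * w′ * b′ → p ^ g ∣ ∣ b - b′ ∣
  ≅⇒^∣cofactor-difference m g {w} {w′} {b} {b′} ¬d (congruent x x′ e) eq =
    ^∣-cancel pp g {w = w} ¬d (subst (p ^ g ∣_) (trans (∣-∣-comm (w * b′) (w * b)) (sym (*-distribˡ-∣-∣ w b b′)))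
      (≅⇒∣ (congruent (x * b′) (x′ * b′) (begin
        w * b′ + p ^ g * (x * b′)      ≡⟨ lem w b′ (p ^ g) x ⟩
        (w + p ^ g * x) * b′           ≡⟨ cong (_* b′) w≅w′ ⟩
        (w′ + p ^ g * x′) * b′         ≡⟨ lem w′ b′ (p ^ g) x′ ⟨
        w′ * b′ + p ^ g * (x′ * b′)    ≡⟨ cong (_+ p ^ g * (x′ * b′)) wb ⟨
        w * b + p ^ g * (x′ * b′) ∎))))
    where
    open ≡-Reasoning
    lem : ∀ w b c x → w * b + c * (x * b) ≡ (w + c * x) * b
    lem = solve-∀
    lem′ : ∀ a b c d → a * b + a * c * d ≡ a * (b + c * d)
    lem′ = solve-∀
    wb : w * b ≡ w′ * b′
    wb = *-cancelˡ-≡ (w * b) (w′ * b′) (p ^ m) {{m^n≢0 p m}} (trans (sym (*-assoc (p ^ m) w b)) (trans eq (*-assoc (p ^ m) w′ b′)))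
    factor : ∀ w x → p ^ m * w + p ^ (m + g) * x ≡ p ^ m * (w + p ^ g * x)
    factor w x = trans (cong (λ t → p ^ m * w + t * x) (^-distribˡ-+-* p m g)) (lem′ (p ^ m) w (p ^ g) x)
    w≅w′ : w + p ^ g * x ≡ w′ + p ^ g * x′
    w≅w′ = *-cancelˡ-≡ _ _ (p ^ m) {{m^n≢0 p m}} (trans (sym (factor w x)) (trans e (factor w′ x′)))

  -- Both numbers are congruent to `n⁺ - n⁻` beyond their own valuations. Reduction modulo one power
  -- of `p` above the smaller valuation shows that the valuations agree, and the case of equal
  -- valuations applies.
  ^∣cofactor-difference : ∀ m m′ e e′ g {w w′ n⁺ n⁻ b b′} → ¬ (p ∣ w) → ¬ (p ∣ w′) → 1 ≤ g → g ≤ e → g ≤ e′ →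
    (p ^ m * w + n⁻) ≅ n⁺ [ p ^ (m + e) ] → (p ^ m′ * w′ + n⁻) ≅ n⁺ [ p ^ (m′ + e′) ] →
    p ^ m * w * b ≡ p ^ m′ * w′ * b′ → p ^ g ∣ ∣ b - b′ ∣
  ^∣cofactor-difference m m′ e e′ g {w} {w′} {n⁺} {n⁻} ¬d ¬d′ 1≤g g≤e g≤e′ h h′ eq = go (<-cmp m m′)
    where
    1+m≤ : ∀ m {e} → g ≤ e → suc m ≤ m + e
    1+m≤ m {e} g≤e = m<m+n m (≤-trans 1≤g g≤e)
    go : Tri (m < m′) (m ≡ m′) (m′ < m) → _
    go (tri< m<m′ _ _) = ⊥-elim (≅⇒valuation≮ {w′ = w′} ¬d m<m′ (≅-common {n = n⁻}
      (≅-weaken (^-∣-mono p (1+m≤ m g≤e)) h) (≅-weaken (^-∣-mono p (≤-trans m<m′ (m≤m+n m′ e′))) h′)))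
    go (tri> _ _ m′<m) = ⊥-elim (≅⇒valuation≮ {w′ = w} ¬d′ m′<m (≅-common {n = n⁻}
      (≅-weaken (^-∣-mono p (1+m≤ m′ g≤e′)) h′) (≅-weaken (^-∣-mono p (≤-trans m′<m (m≤m+n m e))) h)))
    go (tri≈ _ m≡m′ _) = ≅⇒^∣cofactor-difference m g ¬d (≅-common {n = n⁻}
      (≅-weaken (^-∣-mono p (+-monoʳ-≤ m g≤e)) h)
      (≅-weaken (^-∣-mono p (+-monoʳ-≤ m g≤e′)) (subst (λ t → (p ^ t * w′ + n⁻) ≅ n⁺ [ p ^ (t + e′) ]) (sym m≡m′) h′)))
      (trans eq (cong (λ t → p ^ t * w′ * _) (sym m≡m′)))

∣-∣<⇒≡ : ∀ {a b d} → a < d → b < d → d ∣ ∣ a - b ∣ → a ≡ b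
∣-∣<⇒≡ {a} {b} {d} a<d b<d h with ∣ a - b ∣ ≟ 0
... | yes e = ∣m-n∣≡0⇒m≡n e
... | no ne = ⊥-elim (<-irrefl refl (<-≤-trans (≤-<-trans (∣m-n∣≤m⊔n a b) (⊔-lub-< a<d b<d))
                (∣⇒≤ {{≢-nonZero ne}} h)))
  where
  ⊔-lub-< : ∀ {a b d} → a < d → b < d → a ⊔ b < d
  ⊔-lub-< p q = ⊔-lub p q

^-cancelʳ-< : ∀ s {a b} → a ^ s < b ^ s → a < b
^-cancelʳ-< s {a} {b} h = ≰⇒> λ b≤a → <-irrefl refl (<-≤-trans h (^-monoˡ-≤ s b≤a))

module Gap {k} (S : Setting k) where
  open Setting S
  open Smooth S

  -- e records how much more divisible c - (n⁺ - n⁻) is than c itself.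
  Approximates : ℕ → ℕ → Vec ℕ k → Vec ℕ k → Set
  Approximates n⁺ n⁻ c e = ∀ i → 1 ≤ lookup e i → (E c + n⁻) ≅ n⁺ [ lookup ps i ^ (lookup c i + lookup e i) ]

  -- The lower bound for the excess modulus `E e` makes the gap principle effective; the upper bound
  -- limits the number of its roundings.
  CloseTo : ℕ → ℕ → ℕ → Vec ℕ k → Set
  CloseTo q n⁺ n⁻ c = InA c × ∃ λ e → E e ≤ N × N ≤ E e ^ q × Approximates n⁺ n⁻ c e

  -- The members share the modulus `E d`, larger than the `s`-th root of `N`, although each may have
  -- its own excess `e`.
  Class : ℕ → ℕ → ℕ → Vec ℕ k → Vec ℕ k → Set
  Class s n⁺ n⁻ d c = InA c × (∃ λ e → (∀ i → lookup d i ≤ lookup e i) × Approximates n⁺ n⁻ c e) × N < E d ^ s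

  lookup-⊞ : ∀ (a b : Vec ℕ k) i → lookup (a ⊞ b) i ≡ lookup a i + lookup b i
  lookup-⊞ a b i = lookup-zipWith _+_ i a b

  -- Prime by prime, `E d` divides the difference of the cofactors `E b` and `E b′`. Both are
  -- smaller than `E d`, so they coincide.
  class-separated : ∀ {s n⁺ n⁻ d c c′ b b′} → Class s n⁺ n⁻ d c → Class s n⁺ n⁻ d c′ →
    E b ^ s ≤ N → E b′ ^ s ≤ N → c ⊞ b ≡ c′ ⊞ b′ → c ≡ c′ × b ≡ b′
  class-separated {s} {n⁺} {n⁻} {d} {c} {c′} {b} {b′} (_ , (e , d≤e , ap) , N<) (_ , (e′ , d≤e′ , ap′) , _) hb hb′ eq =
    ⊞-cancelʳ c c′ b (trans eq (cong (c′ ⊞_) (sym b≡b′))) , b≡b′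
    where
    step : ∀ i → lookup ps i ^ lookup d i ∣ ∣ E b - E b′ ∣
    step i with lookup d i in eqd
    ... | zero = 1∣ _
    ... | suc g with E-split i c | E-split i c′
    ... | w , Ec , ¬w | w′ , Ec′ , ¬w′ = ^∣cofactor-difference (prime i) (lookup c i) (lookup c′ i) (lookup e i) (lookup e′ i) (suc g)
          ¬w ¬w′ (s≤s z≤n) g≤e g≤e′
          (subst (λ x → (x + n⁻) ≅ n⁺ [ lookup ps i ^ (lookup c i + lookup e i) ]) Ec (ap i (≤-trans (s≤s z≤n) g≤e)))
          (subst (λ x → (x + n⁻) ≅ n⁺ [ lookup ps i ^ (lookup c′ i + lookup e′ i) ]) Ec′ (ap′ i (≤-trans (s≤s z≤n) g≤e′)))
          (subst₂ (λ x y → x * E b ≡ y * E b′) Ec Ec′ (trans (sym (ev-⊞ ps c b)) (trans (cong E eq) (ev-⊞ ps c′ b′))))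
      where
      g≤e = subst (_≤ lookup e i) eqd (d≤e i)
      g≤e′ = subst (_≤ lookup e′ i) eqd (d≤e′ i)
    b≡b′ : b ≡ b′
    b≡b′ = E-inj b b′ (∣-∣<⇒≡ (^-cancelʳ-< s (≤-<-trans hb N<)) (^-cancelʳ-< s (≤-<-trans hb′ N<)) (ev-∣ ps d prime distinct step))

  1≤ψ : 1 ≤ N → 1 ≤ ψ
  1≤ψ 1≤N = ∈-length (as-complete (replicate k 0) (subst (_≤ N) (sym (ev-zero ps)) 1≤N))

  x≤x^s : ∀ {x} s → 1 ≤ x → 1 ≤ s → x ≤ x ^ s
  x≤x^s {x} s 1≤x 1≤s = subst (_≤ x ^ s) (*-identityʳ x) (^-monoʳ-≤ x {{>-nonZero 1≤x}} 1≤s)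

  -- Multiplying a class by all smooth numbers below its modulus produces no coincidences.
  atMost-class : ∀ s n⁺ n⁻ d → 1 ≤ s → 1 ≤ N → AtMost 1 ((2 * s) ^ k) (Class s n⁺ n⁻ d)
  bound (atMost-class s n⁺ n⁻ d 1≤s 1≤N) xs u cs = *-cancelʳ-≤ _ _ ψ {{>-nonZero (1≤ψ 1≤N)}} (begin
    length xs * 1 * ψ                     ≡⟨ cong (_* ψ) (*-identityʳ (length xs)) ⟩
    length xs * ψ                         ≤⟨ *-monoʳ-≤ (length xs) ψ≤ ⟩
    length xs * (length bs * s ^ k)       ≡⟨ *-assoc (length xs) _ _ ⟨
    length xs * length bs * s ^ k         ≤⟨ *-monoˡ-≤ (s ^ k) (subst (λ l → length xs * l ≤ ψ * 2 ^ k) (*-identityʳ (length bs)) (bound products xs u cs)) ⟩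
    ψ * 2 ^ k * s ^ k                     ≡⟨ *-assoc ψ _ _ ⟩
    ψ * (2 ^ k * s ^ k)                   ≡⟨ cong (ψ *_) (^-distribʳ-* k 2 s) ⟨
    ψ * (2 * s) ^ k                       ≡⟨ *-comm ψ _ ⟩
    (2 * s) ^ k * ψ ∎)
    where
    open ≤-Reasoning
    small? : ∀ b → Dec (E b ^ s ≤ N)
    small? b = E b ^ s ≤? N
    bs = filter small? as
    -- The rounded `s`-th roots of all elements of `as` lie in `bs`.
    ψ≤ : ψ ≤ length bs * s ^ k
    ψ≤ = subst (_≤ length bs * s ^ k) (*-identityʳ ψ) (bound (atMost-root {P = InA} s 1≤s (atMost-⊆ bs id)
      (λ {m} h p → ∈-filter⁺ small? (as-complete m (≤-trans (x≤x^s s (1≤E m) 1≤s) (≤-trans h p))) (≤-trans h p)))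
      as as-unique as-sound)
    products : AtMost (length bs * 1) (ψ * 2 ^ k) (Class s n⁺ n⁻ d)
    products = atMost-product {S = λ e → E e ≤ N ^ 2} _⊞_ bs (Uniq.filter⁺ small? as-unique)
      (λ {c} {b} (p , _) b∈ → let (_ , h) = ∈-filter⁻ small? {xs = as} b∈ in begin
        E (c ⊞ b)    ≡⟨ ev-⊞ ps c b ⟩
        E c * E b    ≤⟨ *-mono-≤ p (≤-trans (x≤x^s s (1≤E b) 1≤s) h) ⟩
        N * N        ≡⟨ cong (N *_) (*-identityʳ N) ⟨
        N ^ 2 ∎)
      (λ {c} {c′} {b} {b′} p p′ b∈ b∈′ → class-separated {s} p p′ (proj₂ (∈-filter⁻ small? {xs = as} b∈)) (proj₂ (∈-filter⁻ small? {xs = as} b∈′)))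
      (atMost-power 2 (s≤s z≤n))

  -- Rounding of the moduli.

  module Rounding (q : ℕ) (1≤q : 1 ≤ q) (Y<N : Y ^ (4 * k * q) < N) where

    private
      B = Y ^ (4 * k * q)
      1≤4kq : 1 ≤ 4 * k * q
      1≤4kq = *-mono-≤ (*-mono-≤ {1} {4} (s≤s z≤n) 1≤k) 1≤q
      2≤B : 2 ≤ B
      2≤B = ≤-trans 2≤Y (x≤x^s _ 1≤Y 1≤4kq)
      floorLogB = floorLog B N 2≤B Y<N
      Q = proj₁ floorLogB
      1≤Q = proj₁ (proj₂ floorLogB)
      B^Q<N = proj₁ (proj₂ (proj₂ floorLogB))
      N≤B^ = proj₂ (proj₂ (proj₂ floorLogB))
      -- `M` satisfies `M ^ (4 * k * q) < N ≤ M ^ (8 * k * q)`: since `1 ≤ Q`, the step from `Q` to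
      -- `suc Q` costs at most a doubling of the exponent.
      M = Y ^ Q
      2≤M : 2 ≤ M
      2≤M = ≤-trans 2≤Y (x≤x^s _ 1≤Y 1≤Q)
      2≤p : ∀ i → 2 ≤ lookup ps i
      2≤p i = nonTrivial⇒n>1 _ {{prime⇒nonTrivial (prime i)}}
      ceil : ∀ i → _
      ceil i = ceilLog (lookup ps i) M (2≤p i) 2≤M
      -- A step `h` in the exponent multiplies by at least `M` and at most `p * M`, so all primes
      -- are rounded on a comparable scale.
      h : Vec ℕ k
      h = tabulate (λ i → proj₁ (ceil i))
      h-ok : ∀ i → 1 ≤ lookup h i × M ≤ lookup ps i ^ lookup h i × lookup ps i ^ lookup h i ≤ lookup ps i * M
      h-ok i = subst (λ x → 1 ≤ x × M ≤ lookup ps i ^ x × lookup ps i ^ x ≤ lookup ps i * M)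
        (sym (lookup∘tabulate (λ i → proj₁ (ceil i)) i)) (proj₂ (ceil i))
      instance _ = >-nonZero 1≤Y

    B^2Q : B ^ (2 * Q) ≡ M ^ (8 * q * k)
    B^2Q = trans (^-*-assoc Y (4 * k * q) (2 * Q)) (trans (cong (Y ^_) (lem k q Q)) (sym (^-*-assoc Y Q (8 * q * k))))
      where
      lem : ∀ k q Q → 4 * k * q * (2 * Q) ≡ Q * (8 * q * k)
      lem = solve-∀

    -- Each unit in `f` contributes a factor of at least `M` to a number that is at most `N`, and
    -- `N ≤ M ^ (8 * q * k)`.
    vsum≤ : ∀ f → E (h ⊠ f) ≤ N → vsum f ≤ 8 * q * k
    vsum≤ f l = ^-cancelˡ-≤ 2≤M (begin
      M ^ vsum f         ≤⟨ pow-vsum≤ev M ps h f (λ i → proj₁ (proj₂ (h-ok i))) ⟩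
      E (h ⊠ f)          ≤⟨ l ⟩
      N                  ≤⟨ N≤B^ ⟩
      B ^ suc Q          ≤⟨ ^-monoʳ-≤ B {{>-nonZero (<⇒≤ 2≤B)}} (≤-trans (+-monoˡ-≤ Q 1≤Q) (≤-reflexive (cong (Q +_) (sym (+-identityʳ Q))))) ⟩
      B ^ (2 * Q)        ≡⟨ B^2Q ⟩
      M ^ (8 * q * k) ∎)
      where open ≤-Reasoning

    -- The exponent `4 * k * q` of `B` is spent here: the remainder consists of `k` prime powers of
    -- at most `Y ^ (2 * Q)` each, raised to the power `2 * q`.
    remainder< : ∀ r → r ∈ box h → E r ^ (2 * q) < N
    remainder< r r∈ = begin-strict
      E r ^ (2 * q)                 ≤⟨ ^-monoˡ-≤ (2 * q) (≤-trans (∈-box⇒E≤ r∈) (ev-≤-pow (Y ^ (2 * Q)) ps h h≤)) ⟩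
      ((Y ^ (2 * Q)) ^ k) ^ (2 * q) ≡⟨ cong (_^ (2 * q)) (^-*-assoc Y (2 * Q) k) ⟩
      (Y ^ (2 * Q * k)) ^ (2 * q)   ≡⟨ ^-*-assoc Y (2 * Q * k) (2 * q) ⟩
      Y ^ (2 * Q * k * (2 * q))     ≡⟨ cong (Y ^_) (lem k q Q) ⟩
      Y ^ (4 * k * q * Q)           ≡⟨ ^-*-assoc Y (4 * k * q) Q ⟨
      B ^ Q                         <⟨ B^Q<N ⟩
      N ∎
      where
      open ≤-Reasoning
      lem : ∀ k q Q → 2 * Q * k * (2 * q) ≡ 4 * k * q * Q
      lem = solve-∀
      h≤ : ∀ i → lookup ps i ^ lookup h i ≤ Y ^ (2 * Q)
      h≤ i = begin
        lookup ps i ^ lookup h i  ≤⟨ proj₂ (proj₂ (h-ok i)) ⟩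
        lookup ps i * M           ≤⟨ *-monoˡ-≤ M (ps≤Y i) ⟩
        Y ^ suc Q                 ≤⟨ ^-monoʳ-≤ Y (≤-trans (+-monoˡ-≤ Q 1≤Q) (≤-reflexive (cong (Q +_) (sym (+-identityʳ Q))))) ⟩
        Y ^ (2 * Q) ∎

    -- Otherwise `E e` would split into a factor at most, and a factor below, the `2 * q`-th root of
    -- `N`, against `E e ^ (2 * q) ≥ N * N`.
    rounded-large : ∀ f r e → e ≡ h ⊠ f ⊞ r → r ∈ box h → N ≤ E e ^ q → N < E (h ⊠ f) ^ (2 * q)
    rounded-large f r e refl r∈ N≤ = ≰⇒> λ l → <-irrefl refl (begin-strict
      N * N                                    ≤⟨ *-mono-≤ N≤ N≤ ⟩
      E e ^ q * E e ^ q                        ≡⟨ ^-distribˡ-+-* (E e) q q ⟨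
      E e ^ (q + q)                            ≡⟨ cong₂ _^_ (ev-⊞ ps (h ⊠ f) r) (cong (q +_) (sym (+-identityʳ q))) ⟩
      (E (h ⊠ f) * E r) ^ (2 * q)              ≡⟨ ^-distribʳ-* (2 * q) (E (h ⊠ f)) (E r) ⟩
      E (h ⊠ f) ^ (2 * q) * E r ^ (2 * q)      ≤⟨ *-monoˡ-≤ _ l ⟩
      N * E r ^ (2 * q)                        <⟨ *-monoʳ-< N {{>-nonZero (≤-<-trans z≤n B^Q<N)}} (remainder< r r∈) ⟩
      N * N ∎)
      where open ≤-Reasoning

    -- A direct use of `atMost-vsum` would cost a power exponential in `q`. Division by `8 * q`
    -- first leaves vectors of sum at most `k`, and the remainders cost only `(8 * q) ^ k`.
    atMost-rounded : AtMost 1 (2 ^ (k + k) * (8 * q) ^ k) (λ f → vsum f ≤ 8 * q * k)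
    atMost-rounded = atMost-≡ refl (cong (2 ^ (k + k) *_) (vprod-replicate k (8 * q)))
      (atMost-divMod (replicate k (8 * q)) (replicate≥1 1≤8q) (atMost-vsum k k)
        (λ m r _ l → *-cancelˡ-≤ (8 * q) {{>-nonZero 1≤8q}} (≤-trans (vsum-scale≤ (8 * q) m r) l)))
      where
      1≤8q : 1 ≤ 8 * q
      1≤8q = *-mono-≤ {1} {8} (s≤s z≤n) 1≤q

    -- A choice of the rounded excess, times the size of its class: `128 * (q * q)` is `4 * (8 * q)`
    -- for the roundings times `2 * (2 * q)` for the class with `s = 2 * q`.
    atMost-closeTo : ∀ n⁺ n⁻ → AtMost 1 ((128 * (q * q)) ^ k) (CloseTo q n⁺ n⁻)
    atMost-closeTo n⁺ n⁻ = atMost-≡ refl eq (atMost-cover _≟ᵛ_ {R = λ f → Class (2 * q) n⁺ n⁻ (h ⊠ f)} atMost-rounded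
      (λ f _ → atMost-class (2 * q) n⁺ n⁻ (h ⊠ f) (*-mono-≤ {1} {2} (s≤s z≤n) 1≤q) (≤-trans (s≤s z≤n) B^Q<N))
      (λ { {c} (p , e , Ee≤N , N≤ , ap) → let (f , r , r∈ , eqe) = divMod h e (λ i → proj₁ (h-ok i)) in
         f , vsum≤ f (≤-trans (E≤⊞ (h ⊠ f) r) (subst (λ x → E x ≤ N) eqe Ee≤N)) ,
         p , (e , (λ i → subst (λ x → lookup (h ⊠ f) i ≤ lookup x i) (sym eqe)
                (subst (lookup (h ⊠ f) i ≤_) (sym (lookup-⊞ (h ⊠ f) r i)) (m≤m+n _ _))) , ap) ,
         rounded-large f r e eqe r∈ N≤ }))
      where
      lem : ∀ q → 4 * (8 * q) * (2 * (2 * q)) ≡ 128 * (q * q)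
      lem = solve-∀
      open ≡-Reasoning
      eq : 2 ^ (k + k) * (8 * q) ^ k * (2 * (2 * q)) ^ k ≡ (128 * (q * q)) ^ k
      eq = begin
        2 ^ (k + k) * (8 * q) ^ k * (2 * (2 * q)) ^ k  ≡⟨ cong (λ x → x * (8 * q) ^ k * (2 * (2 * q)) ^ k) (trans (^-distribˡ-+-* 2 k k) (sym (^-distribʳ-* k 2 2))) ⟩
        4 ^ k * (8 * q) ^ k * (2 * (2 * q)) ^ k        ≡⟨ cong (_* (2 * (2 * q)) ^ k) (^-distribʳ-* k 4 (8 * q)) ⟨
        (4 * (8 * q)) ^ k * (2 * (2 * q)) ^ k          ≡⟨ ^-distribʳ-* k (4 * (8 * q)) (2 * (2 * q)) ⟨
        (4 * (8 * q) * (2 * (2 * q))) ^ k              ≡⟨ cong (_^ k) (lem q) ⟩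
        (128 * (q * q)) ^ k ∎

-- Pairs with a given sum or difference

infixl 6 _⊖_

_⊖_ : Vec ℕ k → Vec ℕ k → Vec ℕ k
_⊖_ = zipWith _∸_

_≟ᵖ_ : DecidableEquality (Vec ℕ k × Vec ℕ k)
_≟ᵖ_ = ×-≟ _≟ᵛ_ _≟ᵛ_

∣-∣≡∸+∸ : ∀ x y → ∣ x - y ∣ ≡ (x ∸ y) + (y ∸ x)
∣-∣≡∸+∸ x y with ≤-total x y
... | inj₁ h = trans (m≤n⇒∣m-n∣≡n∸m h) (cong (_+ (y ∸ x)) (sym (m≤n⇒m∸n≡0 h)))
... | inj₂ h = trans (m≤n⇒∣n-m∣≡n∸m h) (trans (sym (+-identityʳ _)) (cong ((x ∸ y) +_) (sym (m≤n⇒m∸n≡0 h))))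

⊟≡⊖⊞⊖ : (a b : Vec ℕ k) → a ⊟ b ≡ (a ⊖ b) ⊞ (b ⊖ a)
⊟≡⊖⊞⊖ [] [] = refl
⊟≡⊖⊞⊖ (x ∷ a) (y ∷ b) = cong₂ _∷_ (∣-∣≡∸+∸ x y) (⊟≡⊖⊞⊖ a b)

large-factor : ∀ N x y q → N ≤ (x * y) ^ q → N ≤ x ^ (2 * q) ⊎ N ≤ y ^ (2 * q)
large-factor N x y q h with N ≤? x ^ (2 * q) | N ≤? y ^ (2 * q)
... | yes p | _ = inj₁ p
... | no _ | yes p = inj₂ p
... | no p | no p′ = ⊥-elim (<-irrefl refl (begin-strict
  x ^ (2 * q) * y ^ (2 * q)      <⟨ *-mono-< (≰⇒> p) (≰⇒> p′) ⟩
  N * N                          ≤⟨ *-mono-≤ h h ⟩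
  (x * y) ^ q * (x * y) ^ q      ≡⟨ ^-distribˡ-+-* (x * y) q q ⟨
  (x * y) ^ (q + q)              ≡⟨ cong (λ z → (x * y) ^ (q + z)) (+-identityʳ q) ⟨
  (x * y) ^ (2 * q)              ≡⟨ ^-distribʳ-* (2 * q) x y ⟩
  x ^ (2 * q) * y ^ (2 * q) ∎))
  where open ≤-Reasoning

-- For valuations `x, y, z, w` of `a, b, c, d` with `a + b = c + d`: if `a` and `c` have the same
-- valuation, this counts the further powers of the prime, beyond that valuation, that divide both
-- `b` and `d`, hence `a - c`.
shared₁ : ℕ → ℕ → ℕ → ℕ → ℕ
shared₁ x y z w with x ≟ z
... | yes _ = (y ⊓ w) ∸ x
... | no _ = 0

shared₁≤ : ∀ x y z w → shared₁ x y z w ≤ y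
shared₁≤ x y z w with x ≟ z
... | yes _ = ≤-trans (m∸n≤m (y ⊓ w) x) (m⊓n≤m y w)
... | no _ = z≤n

shared₁-positive : ∀ x y z w → 1 ≤ shared₁ x y z w → z + shared₁ x y z w ≡ y ⊓ w
shared₁-positive x y z w h with x ≟ z
... | yes refl = m+[n∸m]≡n (<⇒≤ (m∸n≢0⇒n<m {y ⊓ w} {x} (λ e → n≮0 (subst (1 ≤_) e h))))
... | no _ = ⊥-elim (n≮0 h)

⊓≤shared₁ : ∀ {x y z w} → x ≤ y → z ≤ w → x ≡ z → ∣ x - y ∣ ⊓ ∣ z - w ∣ ≤ shared₁ x y z w
⊓≤shared₁ {x} {y} {z} {w} x≤y z≤w x≡z with x ≟ z
... | no ne = ⊥-elim (ne x≡z)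
... | yes refl = ≤-reflexive (trans (cong₂ _⊓_ (m≤n⇒∣m-n∣≡n∸m x≤y) (m≤n⇒∣m-n∣≡n∸m z≤w)) (sym (∸-distribʳ-⊓ x y w)))

-- If `x = y` or `z = w`, the left side is zero. Otherwise the two minima agree, and the term that
-- pairs the smaller entry of one side with the smaller entry of the other equals the left side.
min-difference≤shared : ∀ x y z w → (x ≢ y → z ≢ w → x ⊓ y ≡ z ⊓ w) →
  ∣ x - y ∣ ⊓ ∣ z - w ∣ ≤ (shared₁ x y z w + shared₁ x y w z) + (shared₁ y x z w + shared₁ y x w z)
min-difference≤shared x y z w h = go (x ≟ y) (z ≟ w) (≤-total x y) (≤-total z w)
  where
  s₁ = shared₁ x y z w
  s₂ = shared₁ x y w z
  s₃ = shared₁ y x z w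
  s₄ = shared₁ y x w z
  go : Dec (x ≡ y) → Dec (z ≡ w) → x ≤ y ⊎ y ≤ x → z ≤ w ⊎ w ≤ z → ∣ x - y ∣ ⊓ ∣ z - w ∣ ≤ (s₁ + s₂) + (s₃ + s₄)
  go (yes refl) _ _ _ = ≤-trans (m⊓n≤m _ _) (≤-trans (≤-reflexive (∣n-n∣≡0 x)) z≤n)
  go (no _) (yes refl) _ _ = ≤-trans (m⊓n≤n ∣ x - y ∣ _) (≤-trans (≤-reflexive (∣n-n∣≡0 z)) z≤n)
  go (no p) (no q) (inj₁ x≤y) (inj₁ z≤w) = ≤-trans
    (⊓≤shared₁ x≤y z≤w (trans (sym (m≤n⇒m⊓n≡m x≤y)) (trans (h p q) (m≤n⇒m⊓n≡m z≤w))))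
    (≤-trans (m≤m+n s₁ s₂) (m≤m+n (s₁ + s₂) (s₃ + s₄)))
  go (no p) (no q) (inj₁ x≤y) (inj₂ w≤z) = ≤-trans
    (subst (λ t → ∣ x - y ∣ ⊓ t ≤ s₂) (∣-∣-comm w z)
      (⊓≤shared₁ x≤y w≤z (trans (sym (m≤n⇒m⊓n≡m x≤y)) (trans (h p q) (m≥n⇒m⊓n≡n w≤z)))))
    (≤-trans (m≤n+m s₂ s₁) (m≤m+n (s₁ + s₂) (s₃ + s₄)))
  go (no p) (no q) (inj₂ y≤x) (inj₁ z≤w) = ≤-trans
    (subst (λ t → t ⊓ ∣ z - w ∣ ≤ s₃) (∣-∣-comm y x)
      (⊓≤shared₁ y≤x z≤w (trans (sym (m≥n⇒m⊓n≡n y≤x)) (trans (h p q) (m≤n⇒m⊓n≡m z≤w)))))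
    (≤-trans (m≤m+n s₃ s₄) (m≤n+m (s₃ + s₄) (s₁ + s₂)))
  go (no p) (no q) (inj₂ y≤x) (inj₂ w≤z) = ≤-trans
    (subst₂ (λ t u → t ⊓ u ≤ s₄) (∣-∣-comm y x) (∣-∣-comm w z)
      (⊓≤shared₁ y≤x w≤z (trans (sym (m≥n⇒m⊓n≡n y≤x)) (trans (h p q) (m≥n⇒m⊓n≡n w≤z)))))
    (≤-trans (m≤n+m s₄ s₃) (m≤n+m (s₃ + s₄) (s₁ + s₂)))

sum-valuation : ∀ {p} → Prime p → ∀ {m m′ w w′} → m < m′ → ¬ (p ∣ w) →
  ∃ λ v → p ^ m * w + p ^ m′ * w′ ≡ p ^ m * v × ¬ (p ∣ v)
sum-valuation {p} pp {m} {m′} {w} {w′} m<m′ ¬d with m≤n⇒∃[o]m+o≡n m<m′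
... | o , refl = w + p * (p ^ o * w′) ,
  trans (cong (λ x → p ^ m * w + x * w′) (trans (cong (p *_) (^-distribˡ-+-* p m o)) refl)) (lem (p ^ m) w p (p ^ o) w′) ,
  λ d → ¬d (∣m+n∣m⇒∣n (subst (p ∣_) (+-comm w _) d) (m∣m*n _))
  where
  lem : ∀ a w p b w′ → a * w + p * (a * b) * w′ ≡ a * (w + p * (b * w′))
  lem = solve-∀

sum-valuation-⊓ : ∀ {p} → Prime p → ∀ m m′ {w w′} → m ≢ m′ → ¬ (p ∣ w) → ¬ (p ∣ w′) →
  ∃ λ v → p ^ m * w + p ^ m′ * w′ ≡ p ^ (m ⊓ m′) * v × ¬ (p ∣ v)
sum-valuation-⊓ {p} pp m m′ {w} {w′} ne ¬d ¬d′ with <-cmp m m′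
... | tri< l _ _ = subst (λ x → ∃ λ v → p ^ m * w + p ^ m′ * w′ ≡ p ^ x * v × ¬ (p ∣ v)) (sym (m≤n⇒m⊓n≡m (<⇒≤ l))) (sum-valuation pp l ¬d)
... | tri≈ _ e _ = ⊥-elim (ne e)
... | tri> _ _ l = let (v , e , ¬v) = sum-valuation pp {w′ = w} l ¬d′ in
  v , trans (+-comm (p ^ m * w) _) (trans e (cong (λ x → p ^ x * v) (sym (m≥n⇒m⊓n≡n (<⇒≤ l))))) , ¬v

sum≅ : ∀ {x y z w M} → x + y ≡ z + w → M ∣ y → M ∣ w → (z + 0) ≅ x [ M ]
sum≅ {x} {y} {z} {w} {M} e (divides s refl) (divides t refl) = congruent t s (begin
  z + 0 + M * t   ≡⟨ cong₂ _+_ (+-identityʳ z) (*-comm M t) ⟩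
  z + t * M       ≡⟨ e ⟨
  x + s * M       ≡⟨ cong (x +_) (*-comm s M) ⟩
  x + M * s ∎)
  where open ≡-Reasoning

∣⇒≅ : ∀ {x m n M} → M ∣ x → m ≡ n + x → m ≅ n [ M ]
∣⇒≅ {x} {m} {n} {M} (divides s refl) e = congruent 0 s
  (trans (cong (m +_) (*-zeroʳ M)) (trans (+-identityʳ m) (trans e (cong (n +_) (*-comm s M)))))

module Pairs {k} (S : Setting k) where
  open Setting S
  open Smooth S
  open Gap S

  pow∣E : ∀ a i {m} → m ≤ lookup a i → lookup ps i ^ m ∣ E a
  pow∣E a i {m} h = let (w , e , _) = E-split i a in subst (lookup ps i ^ m ∣_) (sym e) (∣m⇒∣m*n w (^-∣-mono (lookup ps i) h))

  -- `Eq` is a parameter so that a fixed sum and a fixed difference share one argument.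
  FarApart : (ℕ → ℕ → Set) → ℕ → Vec ℕ k × Vec ℕ k → Set
  FarApart Eq q (a , b) = InA a × InA b × Eq (E a) (E b) × N ≤ E (a ⊟ b) ^ q

  lookup-⊖ : ∀ (a b : Vec ℕ k) i → lookup (a ⊖ b) i ≡ lookup a i ∸ lookup b i
  lookup-⊖ a b i = lookup-zipWith _∸_ i a b

  -- Where the exponent in `a` is larger, `E b` is congruent to `n⁺ - n⁻` modulo the full prime
  -- power in `E a`. This exceeds the power in `E b` by the entry of `a ⊖ b`, which therefore serves
  -- as the excess.
  excess-closeTo : ∀ q n⁺ n⁻ a b → InA a → InA b → N ≤ E (a ⊖ b) ^ q → (∀ {M} → M ∣ E a → (E b + n⁻) ≅ n⁺ [ M ]) → CloseTo q n⁺ n⁻ b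
  excess-closeTo q n⁺ n⁻ a b pa pb N≤ c = pb , a ⊖ b ,
    ≤-trans (E-mono (λ i → subst (_≤ lookup a i) (sym (lookup-⊖ a b i)) (m∸n≤m _ (lookup b i)))) pa , N≤ ,
    λ i h → c (pow∣E a i (≤-reflexive (trans (cong (lookup b i +_) (lookup-⊖ a b i))
      (m+[n∸m]≡n (<⇒≤ (m∸n≢0⇒n<m {lookup a i} {lookup b i} (λ e → n≮0 (subst (1 ≤_) (trans (lookup-⊖ a b i) e) h))))))))

  -- One of the parts `a ⊖ b` and `b ⊖ a` is at least the `2 * q`-th root of `N`. Accordingly `b` or
  -- `a` is close to a constant and takes few values, and `Eq` determines the other number.
  atMost-farApart : (Eq : ℕ → ℕ → Set) (n₁⁺ n₁⁻ n₂⁺ n₂⁻ : ℕ) →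
    (∀ {x y M} → Eq x y → M ∣ x → (y + n₁⁻) ≅ n₁⁺ [ M ]) → (∀ {x y M} → Eq x y → M ∣ y → (x + n₂⁻) ≅ n₂⁺ [ M ]) →
    (∀ {x x′ y} → Eq x y → Eq x′ y → x ≡ x′) → (∀ {x y y′} → Eq x y → Eq x y′ → y ≡ y′) →
    ∀ q → 1 ≤ q → Y ^ (4 * k * (2 * q)) < N → AtMost 1 (2 * (128 * (2 * q * (2 * q))) ^ k) (FarApart Eq q)
  atMost-farApart Eq n₁⁺ n₁⁻ n₂⁺ n₂⁻ c₁ c₂ i₁ i₂ q 1≤q Y<N =
    atMost-mono {P = λ { z → Far₁ z ⊎ Far₂ z }} ≤-refl (≤-reflexive (cong (half +_) (sym (+-identityʳ half)))) one-side
      (atMost-⊎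
        (atMost-inj _≟ᵛ_ (λ { b′ (a , b) → b′ ≡ b × Eq (E a) (E b) }) (atMost-closeTo n₁⁺ n₁⁻)
          (λ { {a , b} (pa , pb , e , h) → b , excess-closeTo (2 * q) n₁⁺ n₁⁻ a b pa pb h (c₁ e) , refl , e })
          (λ { {_} {a , b} {a′ , b} (refl , e) (refl , e′) → cong (_, b) (E-inj a a′ (i₁ e e′)) }))
        (atMost-inj _≟ᵛ_ (λ { a′ (a , b) → a′ ≡ a × Eq (E a) (E b) }) (atMost-closeTo n₂⁺ n₂⁻)
          (λ { {a , b} (pa , pb , e , h) → a , excess-closeTo (2 * q) n₂⁺ n₂⁻ b a pb pa h (c₂ e) , refl , e })
          (λ { {_} {a , b} {a , b′} (refl , e) (refl , e′) → cong (a ,_) (E-inj b b′ (i₂ e e′)) })))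
    where
    open Rounding (2 * q) (*-mono-≤ {1} {2} (s≤s z≤n) 1≤q) Y<N
    half = (128 * (2 * q * (2 * q))) ^ k
    Far₁ Far₂ : Vec ℕ k × Vec ℕ k → Set
    Far₁ (a , b) = InA a × InA b × Eq (E a) (E b) × N ≤ E (a ⊖ b) ^ (2 * q)
    Far₂ (a , b) = InA a × InA b × Eq (E a) (E b) × N ≤ E (b ⊖ a) ^ (2 * q)
    one-side : ∀ {z} → FarApart Eq q z → Far₁ z ⊎ Far₂ z
    one-side {a , b} (pa , pb , e , h) with large-factor N (E (a ⊖ b)) (E (b ⊖ a)) q
      (subst (λ x → N ≤ x ^ q) (trans (cong E (⊟≡⊖⊞⊖ a b)) (ev-⊞ ps (a ⊖ b) (b ⊖ a))) h)
    ... | inj₁ l = inj₁ (pa , pb , e , l)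
    ... | inj₂ l = inj₂ (pa , pb , e , l)

  atMost-far-sum : ∀ n q → 1 ≤ q → Y ^ (4 * k * (2 * q)) < N → AtMost 1 (2 * (128 * (2 * q * (2 * q))) ^ k) (FarApart (λ x y → x + y ≡ n) q)
  atMost-far-sum n = atMost-farApart (λ x y → x + y ≡ n) n 0 n 0
    (λ {x} {y} e d → ≅-sym (∣⇒≅ d (trans (sym e) (trans (+-comm x y) (cong (_+ x) (sym (+-identityʳ y)))))))
    (λ {x} {y} e d → ≅-sym (∣⇒≅ d (trans (sym e) (cong (_+ y) (sym (+-identityʳ x))))))
    (λ {x} {x′} {y} e e′ → +-cancelʳ-≡ y x x′ (trans e (sym e′)))
    (λ {x} {y} {y′} e e′ → +-cancelˡ-≡ x y y′ (trans e (sym e′)))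

  atMost-far-difference : ∀ α γ q → 1 ≤ q → Y ^ (4 * k * (2 * q)) < N →
    AtMost 1 (2 * (128 * (2 * q * (2 * q))) ^ k) (FarApart (λ x y → x + α ≡ y + γ) q)
  atMost-far-difference α γ = atMost-farApart (λ x y → x + α ≡ y + γ) α γ γ α
    (λ {x} {y} e d → ∣⇒≅ d (trans (sym e) (+-comm x α)))
    (λ {x} {y} e d → ∣⇒≅ d (trans e (+-comm y γ)))
    (λ {x} {x′} e e′ → +-cancelʳ-≡ α x x′ (trans e (sym e′)))
    (λ {x} {y} {y′} e e′ → +-cancelʳ-≡ γ y y′ (trans (sym e) e′))

  shared minDifference : (a b c d : Vec ℕ k) → Vec ℕ k
  shared a b c d = tabulate (λ i → shared₁ (lookup a i) (lookup b i) (lookup c i) (lookup d i))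
  minDifference a b c d = tabulate (λ i → ∣ lookup a i - lookup b i ∣ ⊓ ∣ lookup c i - lookup d i ∣)

  lookup-shared : ∀ a b c d i → lookup (shared a b c d) i ≡ shared₁ (lookup a i) (lookup b i) (lookup c i) (lookup d i)
  lookup-shared a b c d i = lookup∘tabulate _ i

  lookup-minDifference : ∀ a b c d i → lookup (minDifference a b c d) i ≡ ∣ lookup a i - lookup b i ∣ ⊓ ∣ lookup c i - lookup d i ∣
  lookup-minDifference a b c d i = lookup∘tabulate _ i

  -- At a prime with positive shared exponent, `E b` and `E d` are both divisible by the power with
  -- exponent `lookup b i ⊓ lookup d i`. Modulo that power `E c` agrees with `E a`.
  shared-closeTo : ∀ q a b c d → InA b → InA c → E a + E b ≡ E c + E d → N ≤ E (shared a b c d) ^ q → CloseTo q (E a) 0 c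
  shared-closeTo q a b c d pb pc e N≤ = pc , shared a b c d ,
    ≤-trans (E-mono (λ i → subst (_≤ lookup b i) (sym (lookup-shared a b c d i)) (shared₁≤ (lookup a i) _ _ _))) pb , N≤ ,
    λ i h → let m = trans (cong (lookup c i +_) (lookup-shared a b c d i))
                      (shared₁-positive (lookup a i) _ _ _ (subst (1 ≤_) (lookup-shared a b c d i) h)) in
      sum≅ e (pow∣E b i (≤-trans (≤-reflexive m) (m⊓n≤m _ (lookup d i))))
             (pow∣E d i (≤-trans (≤-reflexive m) (m⊓n≤n (lookup b i) _)))

  -- Both minima are the valuation of the common sum.
  equal-minima : ∀ a b c d → E a + E b ≡ E c + E d → ∀ i → lookup a i ≢ lookup b i → lookup c i ≢ lookup d i →
    lookup a i ⊓ lookup b i ≡ lookup c i ⊓ lookup d i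
  equal-minima a b c d e i a≢b c≢d with E-split i a | E-split i b | E-split i c | E-split i d
  ... | wa , ea , da | wb , eb , db | wc , ec , dc | wd , ed , dd
    with sum-valuation-⊓ (prime i) (lookup a i) (lookup b i) a≢b da db | sum-valuation-⊓ (prime i) (lookup c i) (lookup d i) c≢d dc dd
  ... | v , ev , dv | v′ , ev′ , dv′ = ^*-unique (prime i) _ _ dv dv′
    (trans (sym ev) (trans (sym (cong₂ _+_ ea eb)) (trans e (trans (cong₂ _+_ ec ed) ev′))))

  E-minDifference≤ : ∀ a b c d → E a + E b ≡ E c + E d → E (minDifference a b c d) ≤
    (E (shared a b c d) * E (shared a b d c)) * (E (shared b a c d) * E (shared b a d c))
  E-minDifference≤ a b c d e = begin
    E (minDifference a b c d)
      ≤⟨ E-mono (λ i → subst₂ _≤_ (sym (lookup-minDifference a b c d i)) (sym (look i))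
           (min-difference≤shared (lookup a i) (lookup b i) (lookup c i) (lookup d i) (equal-minima a b c d e i))) ⟩
    E ((shared a b c d ⊞ shared a b d c) ⊞ (shared b a c d ⊞ shared b a d c))
      ≡⟨ trans (ev-⊞ ps (shared a b c d ⊞ shared a b d c) _) (cong₂ _*_ (ev-⊞ ps (shared a b c d) _) (ev-⊞ ps (shared b a c d) _)) ⟩
    (E (shared a b c d) * E (shared a b d c)) * (E (shared b a c d) * E (shared b a d c)) ∎
    where
    open ≤-Reasoning
    look : ∀ i → lookup ((shared a b c d ⊞ shared a b d c) ⊞ (shared b a c d ⊞ shared b a d c)) i ≡
      (shared₁ (lookup a i) (lookup b i) (lookup c i) (lookup d i) + shared₁ (lookup a i) (lookup b i) (lookup d i) (lookup c i)) +
      (shared₁ (lookup b i) (lookup a i) (lookup c i) (lookup d i) + shared₁ (lookup b i) (lookup a i) (lookup d i) (lookup c i))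
    look i = trans (lookup-⊞ (shared a b c d ⊞ shared a b d c) _ i) (cong₂ _+_
      (trans (lookup-⊞ (shared a b c d) _ i) (cong₂ _+_ (lookup-shared a b c d i) (lookup-shared a b d c i)))
      (trans (lookup-⊞ (shared b a c d) _ i) (cong₂ _+_ (lookup-shared b a c d i) (lookup-shared b a d c i))))

-- Ambiguous sums

mask-true : (v : Vec ℕ k) → mask (replicate k true) v ≡ v
mask-true [] = refl
mask-true (x ∷ v) = cong (x ∷_) (mask-true v)

-- Each coordinate contributes its `s * s` either to `z` or to the complement. Hence one of the two
-- products is at least `s ^ k`.
vprod-sel-split : ∀ s (z : Vec Bool k) → vprod (Vec.map (sel (s * s)) z) * vprod (Vec.map (sel (s * s)) (Vec.map not z)) ≡ s ^ k * s ^ k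
vprod-sel-split s [] = refl
vprod-sel-split {suc k} s (b ∷ z) = begin
  sel (s * s) b * vprod (Vec.map (sel (s * s)) z) * (sel (s * s) (not b) * vprod (Vec.map (sel (s * s)) (Vec.map not z)))
    ≡⟨ lem₁ (sel (s * s) b) _ (sel (s * s) (not b)) _ ⟩
  sel (s * s) b * sel (s * s) (not b) * (vprod (Vec.map (sel (s * s)) z) * vprod (Vec.map (sel (s * s)) (Vec.map not z)))
    ≡⟨ cong₂ _*_ (both b) (vprod-sel-split s z) ⟩
  s * s * (s ^ k * s ^ k)
    ≡⟨ lem₁ s s (s ^ k) (s ^ k) ⟩
  s * s ^ k * (s * s ^ k) ∎
  where
  open ≡-Reasoning
  lem₁ : ∀ a b c d → a * b * (c * d) ≡ a * c * (b * d)
  lem₁ = solve-∀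
  both : ∀ b → sel (s * s) b * sel (s * s) (not b) ≡ s * s
  both true = *-identityʳ _
  both false = *-identityˡ _

square-split : ∀ a b c → a * b ≡ c * c → c ≤ a ⊎ c ≤ b
square-split a b c e with c ≤? a | c ≤? b
... | yes p | _ = inj₁ p
... | no _ | yes p = inj₂ p
... | no p | no p′ = ⊥-elim (<-irrefl e (*-mono-< (≰⇒> p) (≰⇒> p′)))

atMost-swap : ∀ {A B : Set} {w n} {P : A × B → Set} → DecidableEquality A → DecidableEquality B →
  AtMost w n P → AtMost w n (λ z → P (swap z))
atMost-swap _≟₁_ _≟₂_ h = atMost-inj (×-≟ _≟₁_ _≟₂_) (λ y z → y ≡ swap z) h (λ {z} p → swap z , p , refl) (λ { refl refl → refl })

-- As powers of t: s = t³, u = t⁶, q = t¹³ and V = t³⁹.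
module Scales (t : ℕ) where

  s u q V Q : ℕ
  s = t * t * t
  u = s * s
  q = u * u * t
  V = u * u * u * u * u * u * (t * t * t)
  Q = 2 * (2 * u)

module Cases {k} (S : Setting k) (t : ℕ) (1≤t : 1 ≤ t) where
  open Scales t
  open Setting S
  open Smooth S
  open Gap S
  open Pairs S

  -- As the sums agree, `c` differing from `a` and `b` forces `d` to differ from them as well.
  Bad : Vec ℕ k × Vec ℕ k → Set
  Bad (a , b) = ∃₂ λ c d → InA a × InA b × InA c × InA d × E a + E b ≡ E c + E d × a ≢ c × b ≢ c

  Shared : (Vec ℕ k → Vec ℕ k → Set) → Vec ℕ k × Vec ℕ k → Set
  Shared R (a , b) = ∃₂ λ c d → InA a × InA b × InA c × InA d × E a + E b ≡ E c + E d × a ≢ c × N ≤ E (shared a b c d) ^ Q × R b d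

  Close Far : Vec ℕ k → Vec ℕ k → Set
  Close b d = E (b ⊟ d) ^ q ≤ N
  Far b d = N ≤ E (b ⊟ d) ^ q

  -- Here `(c , d)` is the pair with few choices; `(a , b)` is counted afterwards through its known
  -- sum.
  NearComplement : Vec ℕ k × Vec ℕ k → Set
  NearComplement (a , b) = ∃₂ λ c d → Near u (s ^ k) (c , d) × FarApart (λ x y → x + y ≡ E c + E d) t (a , b)

  shared-cases : ∀ {a b c d} → InA a → InA b → InA c → InA d → E a + E b ≡ E c + E d → a ≢ c → N ≤ E (shared a b c d) ^ Q →
    Shared Close (a , b) ⊎ Shared Far (a , b)
  shared-cases {b = b} {d = d} pa pb pc pd e ne h with E (b ⊟ d) ^ q ≤? N
  ... | yes l = inj₁ (_ , _ , pa , pb , pc , pd , e , ne , h , l)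
  ... | no l = inj₂ (_ , _ , pa , pb , pc , pd , e , ne , h , <⇒≤ (≰⇒> l))

  closeSet : (a b c d : Vec ℕ k) → Vec Bool k
  closeSet a b c d = tabulate (λ i → ∣ lookup a i - lookup b i ∣ ≤ᵇ ∣ lookup c i - lookup d i ∣)

  mask-close≤ : ∀ a b c d i → lookup (mask (closeSet a b c d) (a ⊟ b)) i ≤ lookup (minDifference a b c d) i
  mask-close≤ a b c d i rewrite lookup-zipWith (λ z x → if z then x else 0) i (closeSet a b c d) (a ⊟ b)
    | lookup∘tabulate (λ i → ∣ lookup a i - lookup b i ∣ ≤ᵇ ∣ lookup c i - lookup d i ∣) i
    | lookup-zipWith ∣_-_∣ i a b | lookup-minDifference a b c d i
    with ≤ᵇ-cases ∣ lookup a i - lookup b i ∣ ∣ lookup c i - lookup d i ∣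
  ... | inj₁ (e , l) rewrite e = ≤-reflexive (sym (m≤n⇒m⊓n≡m l))
  ... | inj₂ (e , l) rewrite e = z≤n

  mask-far≤ : ∀ a b c d i → lookup (mask (Vec.map not (closeSet a b c d)) (c ⊟ d)) i ≤ lookup (minDifference a b c d) i
  mask-far≤ a b c d i rewrite lookup-zipWith (λ z x → if z then x else 0) i (Vec.map not (closeSet a b c d)) (c ⊟ d)
    | lookup-map i not (closeSet a b c d)
    | lookup∘tabulate (λ i → ∣ lookup a i - lookup b i ∣ ≤ᵇ ∣ lookup c i - lookup d i ∣) i
    | lookup-zipWith ∣_-_∣ i c d | lookup-minDifference a b c d i
    with ≤ᵇ-cases ∣ lookup a i - lookup b i ∣ ∣ lookup c i - lookup d i ∣
  ... | inj₁ (e , l) rewrite e = z≤n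
  ... | inj₂ (e , l) rewrite e = ≤-reflexive (sym (m≥n⇒m⊓n≡n l))

  NearCases SharedCases : Vec ℕ k × Vec ℕ k → Set
  NearCases z = Near t (t ^ k) z ⊎ (Near u (s ^ k) z ⊎ NearComplement z)
  SharedCases z = Shared Close z ⊎ Shared Far z

  classify : ∀ {z} → Bad z → NearCases z ⊎ (SharedCases z ⊎ SharedCases (swap z))
  classify {a , b} (c , d , pa , pb , pc , pd , e , a≢c , b≢c) with E (a ⊟ b) ^ t ≤? N | N ≤? E (minDifference a b c d) ^ u
  ... | yes h | _ = inj₁ (inj₁ (pa , pb , replicate k true ,
          ≤-reflexive (sym (trans (cong vprod (map-replicate (sel t) true k)) (vprod-replicate k t))) ,
          subst (λ v → E v ^ t ≤ N) (sym (mask-true (a ⊟ b))) h))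
  -- Since `u = s * s`, the coordinates where `a` and `b` are the closer pair, or the remaining
  -- ones, have weight at least `s ^ k`.
  ... | no h | no l with square-split (vprod (Vec.map (sel u) (closeSet a b c d))) _ (s ^ k) (vprod-sel-split s (closeSet a b c d))
  ...   | inj₁ w = inj₁ (inj₂ (inj₁ (pa , pb , closeSet a b c d , w ,
            ≤-trans (^-monoˡ-≤ u (E-mono (mask-close≤ a b c d))) (<⇒≤ (≰⇒> l)))))
  -- The failed first test says that `a` and `b` are far apart, as the count through a known sum
  -- requires.
  ...   | inj₂ w = inj₁ (inj₂ (inj₂ (c , d , (pc , pd , Vec.map not (closeSet a b c d) , w ,
            ≤-trans (^-monoˡ-≤ u (E-mono (mask-far≤ a b c d))) (<⇒≤ (≰⇒> l))) , pa , pb , e , <⇒≤ (≰⇒> h))))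
  -- Two halvings of a product of four factors lead to the exponent `Q = 2 * (2 * u)`. Exchanging
  -- `c` with `d`, or `a` with `b`, moves the large factor to `shared a b c d`; the second exchange
  -- accounts for `swap z`.
  classify {a , b} (c , d , pa , pb , pc , pd , e , a≢c , b≢c) | no h | yes l = inj₂ (go
      (large-factor N (E (shared a b c d) * E (shared a b d c)) (E (shared b a c d) * E (shared b a d c)) u
        (≤-trans l (^-monoˡ-≤ u (E-minDifference≤ a b c d e)))))
    where
    e-ab = trans e (+-comm (E c) (E d))
    e-ba = trans (+-comm (E b) (E a)) e
    a≢d : a ≢ d
    a≢d refl = b≢c (E-inj b c (+-cancelˡ-≡ (E a) _ _ (trans e (+-comm (E c) (E a)))))
    b≢d : b ≢ d
    b≢d refl = a≢c (E-inj a c (+-cancelʳ-≡ (E b) _ _ e))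
    go : N ≤ (E (shared a b c d) * E (shared a b d c)) ^ (2 * u) ⊎ N ≤ (E (shared b a c d) * E (shared b a d c)) ^ (2 * u) →
      SharedCases (a , b) ⊎ SharedCases (b , a)
    go (inj₁ m) with large-factor N _ _ (2 * u) m
    ... | inj₁ x = inj₁ (shared-cases pa pb pc pd e a≢c x)
    ... | inj₂ x = inj₁ (shared-cases pa pb pd pc e-ab a≢d x)
    go (inj₂ m) with large-factor N _ _ (2 * u) m
    ... | inj₁ x = inj₂ (shared-cases pb pa pc pd e-ba b≢c x)
    ... | inj₂ x = inj₂ (shared-cases pb pa pd pc (trans e-ba (+-comm (E c) (E d))) b≢d x)

  -- Bounds for the separate cases.

  module _ (big : Y ^ (4 * k * (4 * V)) < N) where

    1≤s : 1 ≤ s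
    1≤s = *-mono-≤ (*-mono-≤ 1≤t 1≤t) 1≤t
    1≤u : 1 ≤ u
    1≤u = *-mono-≤ 1≤s 1≤s
    1≤q : 1 ≤ q
    1≤q = *-mono-≤ (*-mono-≤ 1≤u 1≤u) 1≤t

    u≤V : u ≤ V
    u≤V = subst (u ≤_) (lem u s) (m≤m*n u (u * u * u * u * u * s) {{>-nonZero (*-mono-≤ (*-mono-≤ (*-mono-≤ (*-mono-≤ (*-mono-≤ 1≤u 1≤u) 1≤u) 1≤u) 1≤u) 1≤s)}})
      where
      lem : ∀ u s → u * (u * u * u * u * u * s) ≡ u * u * u * u * u * u * s
      lem = solve-∀
    t≤V : t ≤ V
    t≤V = subst (t ≤_) (lem t (u * u * u * u * u * u)) (m≤m*n t _ {{>-nonZero (*-mono-≤ (*-mono-≤ (*-mono-≤ (*-mono-≤ (*-mono-≤ (*-mono-≤ 1≤u 1≤u) 1≤u) 1≤u) 1≤u) 1≤u) (*-mono-≤ 1≤t 1≤t))}})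
      where
      lem : ∀ t z → t * (z * (t * t)) ≡ z * (t * t * t)
      lem = solve-∀
    q≤V : q ≤ V
    q≤V = subst (q ≤_) (lem t u) (m≤m*n q _ {{>-nonZero (*-mono-≤ (*-mono-≤ (*-mono-≤ (*-mono-≤ 1≤u 1≤u) 1≤u) 1≤u) (*-mono-≤ 1≤t 1≤t))}})
      where
      lem : ∀ t u → u * u * t * (u * u * u * u * (t * t)) ≡ u * u * u * u * u * u * (t * t * t)
      lem = solve-∀

    Y-mono : ∀ {x} → x ≤ 4 * V → Y ^ (4 * k * x) < N
    Y-mono h = ≤-<-trans (^-monoʳ-≤ Y {{>-nonZero 1≤Y}} (*-monoʳ-≤ (4 * k) h)) big

    Y-mono′ : ∀ {x} → x ≤ V → Y ^ (k * x) ≤ N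
    Y-mono′ {x} h = <⇒≤ (≤-<-trans (^-monoʳ-≤ Y {{>-nonZero 1≤Y}} (*-mono-≤ (m≤m+n k _) (≤-trans h (m≤m+n V _)))) big)

    double : ∀ {x} → x ≤ V → 2 * x ≤ 4 * V
    double h = *-mono-≤ {2} {4} (s≤s (s≤s z≤n)) h

    Q≤4V : Q ≤ 4 * V
    Q≤4V = ≤-trans (≤-reflexive (sym (*-assoc 2 2 u))) (*-monoʳ-≤ 4 u≤V)

    1≤Q : 1 ≤ Q
    1≤Q = *-mono-≤ {1} {2} (s≤s z≤n) (*-mono-≤ {1} {2} (s≤s z≤n) 1≤u)

    pairBound : ℕ
    pairBound = ψ * 4 ^ k * (ψ * 3 ^ k)

    atMost-nearComplement : AtMost (s ^ k) (pairBound * (2 * (128 * (2 * t * (2 * t))) ^ k)) NearComplement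
    atMost-nearComplement = atMost-≡ (*-identityʳ _) refl (atMost-cover _≟ᵖ_ {R = λ { (c , d) z → FarApart (λ x y → x + y ≡ E c + E d) t z }}
      (atMost-near u (s ^ k) 1≤u (Y-mono′ u≤V))
      (λ { (c , d) _ → atMost-far-sum (E c + E d) t 1≤t (Y-mono (double t≤V)) })
      (λ { {a , b} (c , d , n , f) → (c , d) , n , f }))

    Start : Vec ℕ k × Vec ℕ k → Set
    Start (a , c) = a ≢ c × InA a × CloseTo Q (E a) 0 c

    atMost-start : AtMost 1 (ψ * (128 * (Q * Q)) ^ k) Start
    atMost-start = atMost-mono ≤-refl ≤-refl proj₂
      (atMost-pair _≟ᵛ_ atMost-A (λ a _ → Rounding.atMost-closeTo Q 1≤Q (Y-mono Q≤4V) (E a) 0))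

    -- After `a` and `c`, the difference of `b` and `d` is known and, because `a ≢ c`, nonzero. The
    -- pairs `(b , d)` are counted and `d` is then forgotten.
    atMost-sharedClose : AtMost (q ^ k) (ψ * (128 * (Q * Q)) ^ k * (2 ^ k * (ψ * 3 ^ k))) (Shared Close)
    atMost-sharedClose = atMost-≡ (*-identityˡ _) refl (atMost-cover _≟ᵖ_
      {R = λ { (a , c) (a′ , b) → a′ ≡ a × ∃ λ d → CloseDifference q (E a) (E c) (b , d) }}
      atMost-start
      (λ { (a , c) (a≢c , _) → atMost-inj _≟ᵖ_ (λ { (b , d) (a′ , b′) → a′ ≡ a × b′ ≡ b })
        (atMost-closeDifference q (E a) (E c) 1≤q (Y-mono′ q≤V) (a≢c ∘ E-inj a c))
        (λ { (refl , d , cd) → (_ , d) , cd , refl , refl }) (λ { (refl , refl) (refl , refl) → refl }) })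
      (λ { {a , b} (c , d , pa , pb , pc , pd , e , ne , h , l) → (a , c) , (ne , pa , shared-closeTo Q a b c d pb pc e h) ,
         refl , d , trans (+-comm (E b) (E a)) (trans e (+-comm (E c) (E d))) , l }))

    -- Only `a` is a free choice, so the bound contains a single factor `ψ`; the saving comes from
    -- the missing second one.
    atMost-sharedFar : AtMost 1 (ψ * (128 * (Q * Q)) ^ k * (2 * (128 * (2 * q * (2 * q))) ^ k)) (Shared Far)
    atMost-sharedFar = atMost-cover _≟ᵖ_
      {R = λ { (a , c) (a′ , b) → a′ ≡ a × ∃ λ d → FarApart (λ x y → x + E a ≡ y + E c) q (b , d) }}
      atMost-start
      (λ { (a , c) _ → atMost-inj _≟ᵖ_ (λ { (b , d) (a′ , b′) → a′ ≡ a × b′ ≡ b })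
        (atMost-far-difference (E a) (E c) q 1≤q (Y-mono (double q≤V)))
        (λ { (refl , d , f) → (_ , d) , f , refl , refl }) (λ { (refl , refl) (refl , refl) → refl }) })
      (λ { {a , b} (c , d , pa , pb , pc , pd , e , ne , h , l) → (a , c) , (ne , pa , shared-closeTo Q a b c d pb pc e h) ,
         refl , d , pb , pd , trans (+-comm (E b) (E a)) (trans e (+-comm (E c) (E d))) , l })

    -- `atMost-spread` applied to the zero vector alone: its box already consists of `V ^ k`
    -- exponent vectors.
    V^k≤ψ3^k : V ^ k ≤ ψ * 3 ^ k
    V^k≤ψ3^k = subst₂ _≤_ (trans (*-identityˡ _) (vprod-replicate k V)) refl
      (bound (atMost-spread (replicate k V) (replicate≥1 (≤-trans 1≤t t≤V))
        (≤-trans (E≤pow _ (λ i → ≤-reflexive (lookup-replicate i V))) (Y-mono′ ≤-refl)))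
        (replicate k 0 ∷ []) ([] ∷ []) (zero-ok ∷ []))
      where
      1≤N = ≤-<-trans z≤n big
      zero-ok : E (replicate k V ⊠ replicate k 0) ≤ N * N
      zero-ok = subst (_≤ N * N) (sym (trans (E-replicate-⊠ V (replicate k 0)) (trans (cong (_^ V) (ev-zero ps)) (^-zeroˡ V))))
        (*-mono-≤ 1≤N 1≤N)

    -- Each case loses a factor `C ^ k`. The largest `C` is `6291456 = 2 * 2048 * 512 * 3`, from
    -- `sharedFar`.
    module _ (κ : ℕ) (κ-large : 6291456 ≤ κ) where

      private
        T = t ^ k
        U = u ^ k
        G : ℕ
        G = κ ^ k * (ψ * ψ)

        D : ∀ x y → (x * y) ^ k ≡ x ^ k * y ^ k
        D = ^-distribʳ-* k

        ^k≤ : ∀ {x} → x ≤ 6291456 → x ^ k ≤ κ ^ k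
        ^k≤ h = ^-monoˡ-≤ k (≤-trans h κ-large)

        2*≤ : ∀ x → 2 * x ^ k ≤ (2 * x) ^ k
        2*≤ x = ≤-trans (*-monoˡ-≤ (x ^ k) (x≤x^s k (s≤s z≤n) 1≤k)) (≤-reflexive (sym (D 2 x)))

        pairBound-eq : pairBound ≡ 12 ^ k * (ψ * ψ)
        pairBound-eq = trans (lem ψ (4 ^ k) (3 ^ k)) (cong (_* (ψ * ψ)) (sym (D 4 3)))
          where
          lem : ∀ p a b → p * a * (p * b) ≡ a * b * (p * p)
          lem = solve-∀

        S-eq : s ^ k ≡ T * T * T
        S-eq = trans (D (t * t) t) (cong (_* T) (D t t))

        q-eq : q ^ k ≡ U * U * T
        q-eq = trans (D (u * u) t) (cong (_* T) (D u u))

        1≤T : 1 ≤ T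
        1≤T = m^n>0 t {{>-nonZero 1≤t}} k
        1≤U : 1 ≤ U
        1≤U = m^n>0 u {{>-nonZero 1≤u}} k

        quad : ∀ x → (128 * (2 * x * (2 * x))) ^ k ≡ 512 ^ k * (x ^ k * x ^ k)
        quad x = trans (cong (_^ k) (lem x)) (trans (D 512 (x * x)) (cong (512 ^ k *_) (D x x)))
          where
          lem : ∀ x → 128 * (2 * x * (2 * x)) ≡ 512 * (x * x)
          lem = solve-∀

        quadQ : (128 * (Q * Q)) ^ k ≡ 2048 ^ k * (U * U)
        quadQ = trans (cong (_^ k) (lem u)) (trans (D 2048 (u * u)) (cong (2048 ^ k *_) (D u u)))
          where
          lem : ∀ u → 128 * (2 * (2 * u) * (2 * (2 * u))) ≡ 2048 * (u * u)
          lem = solve-∀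

        T≤S : T ≤ s ^ k
        T≤S = ≤-trans (m≤n*m T (T * T) {{>-nonZero (*-mono-≤ 1≤T 1≤T)}}) (≤-reflexive (sym S-eq))

        pairBound≤G : pairBound ≤ G
        pairBound≤G = ≤-trans (≤-reflexive pairBound-eq) (*-monoˡ-≤ (ψ * ψ) (^k≤ (≤ᵇ⇒≤ 12 6291456 tt)))

        near₁ : AtMost T G (Near t T)
        near₁ = atMost-mono ≤-refl pairBound≤G id (atMost-near t T 1≤t (Y-mono′ t≤V))

        near₂ : AtMost T G (Near u (s ^ k))
        near₂ = atMost-mono T≤S pairBound≤G id (atMost-near u (s ^ k) 1≤u (Y-mono′ u≤V))

        -- Up to constants, the count with known sum costs `T * T`; the weight `s ^ k = T * T * T`
        -- pays for it with one `T` to spare.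
        near₃ : AtMost T G NearComplement
        near₃ = atMost-mono ≤-refl n≤ id (atMost-cancel (T * T) {{>-nonZero (*-mono-≤ 1≤T 1≤T)}} (atMost-≡ S-eq eq atMost-nearComplement))
          where
          open ≡-Reasoning
          eq : pairBound * (2 * (128 * (2 * t * (2 * t))) ^ k) ≡ T * T * (2 * 6144 ^ k * (ψ * ψ))
          eq = begin
            pairBound * (2 * (128 * (2 * t * (2 * t))) ^ k)   ≡⟨ cong₂ (λ x y → x * (2 * y)) pairBound-eq (quad t) ⟩
            12 ^ k * (ψ * ψ) * (2 * (512 ^ k * (T * T)))      ≡⟨ lem (12 ^ k) (ψ * ψ) (512 ^ k) (T * T) ⟩
            T * T * (2 * (12 ^ k * 512 ^ k) * (ψ * ψ))        ≡⟨ cong (λ x → T * T * (2 * x * (ψ * ψ))) (D 12 512) ⟨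
            T * T * (2 * 6144 ^ k * (ψ * ψ)) ∎
            where
            lem : ∀ a p b t → a * p * (2 * (b * t)) ≡ t * (2 * (a * b) * p)
            lem = solve-∀
          n≤ : 2 * 6144 ^ k * (ψ * ψ) ≤ G
          n≤ = *-monoˡ-≤ (ψ * ψ) (≤-trans (2*≤ 6144) (^k≤ (≤ᵇ⇒≤ 12288 6291456 tt)))

        -- The choice of `c` costs `U * U` up to constants, and the weight `q ^ k = U * U * T`
        -- leaves `T`.
        sharedClose : AtMost T G (Shared Close)
        sharedClose = atMost-mono ≤-refl (*-monoˡ-≤ (ψ * ψ) (^k≤ (≤ᵇ⇒≤ 12288 6291456 tt))) id
          (atMost-cancel (U * U) {{>-nonZero (*-mono-≤ 1≤U 1≤U)}} (atMost-≡ q-eq eq atMost-sharedClose))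
          where
          open ≡-Reasoning
          eq : ψ * (128 * (Q * Q)) ^ k * (2 ^ k * (ψ * 3 ^ k)) ≡ U * U * (12288 ^ k * (ψ * ψ))
          eq = begin
            ψ * (128 * (Q * Q)) ^ k * (2 ^ k * (ψ * 3 ^ k))   ≡⟨ cong (λ x → ψ * x * (2 ^ k * (ψ * 3 ^ k))) quadQ ⟩
            ψ * (2048 ^ k * (U * U)) * (2 ^ k * (ψ * 3 ^ k))  ≡⟨ lem ψ (2048 ^ k) (U * U) (2 ^ k) (3 ^ k) ⟩
            U * U * (2048 ^ k * 2 ^ k * 3 ^ k * (ψ * ψ))      ≡⟨ cong (λ x → U * U * (x * 3 ^ k * (ψ * ψ))) (D 2048 2) ⟨
            U * U * (4096 ^ k * 3 ^ k * (ψ * ψ))              ≡⟨ cong (λ x → U * U * (x * (ψ * ψ))) (D 4096 3) ⟨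
            U * U * (12288 ^ k * (ψ * ψ)) ∎
            where
            lem : ∀ p a u b c → p * (a * u) * (b * (p * c)) ≡ u * (a * b * c * (p * p))
            lem = solve-∀

        -- The cost `U * U` of `c`, the cost `q ^ k * q ^ k` of `b` and the desired weight `T`
        -- multiply to exactly `V ^ k`, which `V^k≤ψ3^k` trades for the second factor `ψ`.
        sharedFar : AtMost T G (Shared Far)
        sharedFar = atMost-≡ (*-identityʳ T) refl (atMost-mono ≤-refl n≤ id (atMost-scale T atMost-sharedFar))
          where
          open ≤-Reasoning
          V-eq : U * U * (U * U * T * (U * U * T)) * T ≡ V ^ k
          V-eq = sym (begin-equality
            V ^ k                                             ≡⟨ D (u * u * u * u * u * u) s ⟩
            (u * u * u * u * u * u) ^ k * s ^ k               ≡⟨ cong₂ _*_ (trans (D (u * u * u * u * u) u) (cong (_* U) (trans (D (u * u * u * u) u) (cong (_* U) (trans (D (u * u * u) u) (cong (_* U) (trans (D (u * u) u) (cong (_* U) (D u u))))))))) S-eq ⟩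
            U * U * U * U * U * U * (T * T * T)               ≡⟨ lem U T ⟩
            U * U * (U * U * T * (U * U * T)) * T ∎)
            where
            lem : ∀ u t → u * u * u * u * u * u * (t * t * t) ≡ u * u * (u * u * t * (u * u * t)) * t
            lem = solve-∀
          n≤ : T * (ψ * (128 * (Q * Q)) ^ k * (2 * (128 * (2 * q * (2 * q))) ^ k)) ≤ G
          n≤ = begin
            T * (ψ * (128 * (Q * Q)) ^ k * (2 * (128 * (2 * q * (2 * q))) ^ k))
              ≡⟨ cong₂ (λ x y → T * (ψ * x * (2 * y))) quadQ (trans (quad q) (cong (λ x → 512 ^ k * (x * x)) q-eq)) ⟩
            T * (ψ * (2048 ^ k * (U * U)) * (2 * (512 ^ k * (U * U * T * (U * U * T)))))
              ≡⟨ lem T ψ (2048 ^ k) (U * U) (512 ^ k) (U * U * T * (U * U * T)) ⟩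
            2 * (2048 ^ k * 512 ^ k) * (ψ * (U * U * (U * U * T * (U * U * T)) * T))
              ≡⟨ cong₂ (λ x y → 2 * x * (ψ * y)) (sym (D 2048 512)) V-eq ⟩
            2 * 1048576 ^ k * (ψ * V ^ k)
              ≤⟨ *-mono-≤ (2*≤ 1048576) (*-monoʳ-≤ ψ V^k≤ψ3^k) ⟩
            2097152 ^ k * (ψ * (ψ * 3 ^ k))
              ≡⟨ lem′ (2097152 ^ k) ψ (3 ^ k) ⟩
            2097152 ^ k * 3 ^ k * (ψ * ψ)
              ≡⟨ cong (_* (ψ * ψ)) (D 2097152 3) ⟨
            6291456 ^ k * (ψ * ψ)
              ≤⟨ *-monoˡ-≤ (ψ * ψ) (^k≤ ≤-refl) ⟩
            G ∎
            where
            lem : ∀ t p a u b v → t * (p * (a * u) * (2 * (b * v))) ≡ 2 * (a * b) * (p * (u * v * t))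
            lem = solve-∀
            lem′ : ∀ a p b → a * (p * (p * b)) ≡ a * b * (p * p)
            lem′ = solve-∀

      atMost-bad : AtMost (t ^ k) (8 * (κ ^ k * (ψ * ψ))) Bad
      -- Seven families, rounded up to eight.
      atMost-bad = atMost-mono ≤-refl (≤-trans (≤-reflexive (lem G)) (*-monoˡ-≤ G {7} {8} (n≤1+n 7))) classify
        (atMost-⊎ (atMost-⊎ near₁ (atMost-⊎ near₂ near₃))
          (atMost-⊎ (atMost-⊎ sharedClose sharedFar)
                    (atMost-swap _≟ᵛ_ _≟ᵛ_ (atMost-⊎ sharedClose sharedFar))))
        where
        lem : ∀ g → (g + (g + g)) + ((g + g) + (g + g)) ≡ 7 * g
        lem = solve-∀

-- Bounds for the number of primes

primesUpTo : ℕ → List ℕ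
primesUpTo n = filter prime? (upTo (suc n))

π : ℕ → ℕ
π n = length (primesUpTo n)

unique-primesUpTo : ∀ n → Unique (primesUpTo n)
unique-primesUpTo n = Uniq.filter⁺ prime? (Uniq.upTo⁺ (suc n))

∈-primesUpTo⁺ : ∀ {n p} → Prime p → p ≤ n → p ∈ primesUpTo n
∈-primesUpTo⁺ pp h = ∈-filter⁺ prime? (∈-upTo⁺ (s≤s h)) pp

∈-primesUpTo⁻ : ∀ {n p} → p ∈ primesUpTo n → Prime p × p ≤ n
∈-primesUpTo⁻ {n} i = let (j , pp) = ∈-filter⁻ prime? {xs = upTo (suc n)} i in pp , s≤s⁻¹ (∈-upTo⁻ j)

π-mono : ∀ {m n} → m ≤ n → π m ≤ π n
π-mono {m} {n} h = unique-⊆⇒length≤ (primesUpTo m) (primesUpTo n) (unique-primesUpTo m)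
  (λ i → let (pp , l) = ∈-primesUpTo⁻ {m} i in ∈-primesUpTo⁺ pp (≤-trans l h))

nCk≤2^n : ∀ n k → n C k ≤ 2 ^ n
nCk≤2^n zero zero = ≤-refl
nCk≤2^n zero (suc k) = z≤n
nCk≤2^n (suc n) zero = m^n>0 2 (suc n)
nCk≤2^n (suc n) (suc k) = begin
  suc n C suc k         ≡⟨ nCk+nC[k+1]≡[n+1]C[k+1] n k ⟨
  n C k + n C suc k     ≤⟨ +-mono-≤ (nCk≤2^n n k) (nCk≤2^n n (suc k)) ⟩
  2 ^ n + 2 ^ n         ≡⟨ cong (2 ^ n +_) (sym (+-identityʳ _)) ⟩
  2 ^ suc n ∎
  where open ≤-Reasoning

prime∣!⇒≤ : ∀ {p} → Prime p → ∀ n → p ∣ n ! → p ≤ n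
prime∣!⇒≤ pp zero d with ∣1⇒≡1 d | prime⇒nonTrivial pp
... | refl | ()
prime∣!⇒≤ pp (suc n) d with euclidsLemma (suc n) (n !) pp d
... | inj₁ x = ∣⇒≤ x
... | inj₂ y = m≤n⇒m≤1+n (prime∣!⇒≤ pp n y)

≤⇒∣! : ∀ {p n} → 1 ≤ p → p ≤ n → p ∣ n !
≤⇒∣! {suc p} _ h = ∣-trans (m∣m*n (p !)) (m≤n⇒m!∣n! h)

product-primes-∣ : ∀ {m} ps → Unique ps → All Prime ps → All (_∣ m) ps → product ps ∣ m
product-primes-∣ [] _ _ _ = 1∣ _
product-primes-∣ (p ∷ ps) (p∉ ∷ u) (pp ∷ prs) (d ∷ ds) with product-primes-∣ ps u prs ds
... | divides c refl with euclidsLemma c (product ps) pp d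
...   | inj₁ x = *-monoˡ-∣ (product ps) x
...   | inj₂ y = ⊥-elim (All.lookup p∉ (factorisationHasAllPrimeFactors pp y prs) refl)

pow≤product : ∀ n ps → All (n ≤_) ps → n ^ length ps ≤ product ps
pow≤product n [] [] = ≤-refl
pow≤product n (p ∷ ps) (h ∷ hs) = *-mono-≤ h (pow≤product n ps hs)

central-binomial : ∀ n → 1 ≤ (n + n) C n × ((n + n) C n) * (n ! * n !) ≡ (n + n) !
central-binomial n = n≢0⇒n>0 (λ e → ≢-nonZero⁻¹ ((n + n) !) {{(n + n) !≢0}} (trans (sym eq) (cong (_* (n ! * n !)) e))) , eq
  where
  d : n ! * n ! ∣ (n + n) !
  d = subst (λ m → n ! * m ! ∣ (n + n) !) (m+n∸n≡m n n) (k![n∸k]!∣n! (m≤m+n n n))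
  eq : ((n + n) C n) * (n ! * n !) ≡ (n + n) !
  eq = trans (cong (((n + n) C n) *_) (cong (λ m → n ! * m !) (sym (m+n∸n≡m n n))))
    (trans (cong (_* (n ! * (n + n ∸ n) !)) (nCk≡n!/k![n-k]! (m≤m+n n n)))
      (m/n*n≡m {{n !* (n + n ∸ n) !≢0}} (k![n∸k]!∣n! (m≤m+n n n))))

-- The primes in (n, 2n] divide the central binomial coefficient, which is at most 4^n.
π-double : ∀ n → ∃ λ r → π (n + n) ≤ π n + r × n ^ r ≤ 2 ^ (n + n)
π-double n = length large , split≤ , (begin
  n ^ length large       ≤⟨ pow≤product n large (All.tabulate (λ i → <⇒≤ (proj₂ (large-prime i)))) ⟩
  product large          ≤⟨ ∣⇒≤ {{>-nonZero (proj₁ (central-binomial n))}} (product-primes-∣ large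
                              (Uniq.filter⁺ D (unique-primesUpTo (n + n))) (All.tabulate (λ i → proj₁ (proj₁ (large-prime i)))) (All.tabulate divides-binomial)) ⟩
  (n + n) C n            ≤⟨ nCk≤2^n (n + n) n ⟩
  2 ^ (n + n) ∎)
  where
  open ≤-Reasoning
  D : ∀ p → Dec (n < p)
  D p = n <? p
  large = filter D (primesUpTo (n + n))
  small = filter (¬? ∘ D) (primesUpTo (n + n))
  large-prime : ∀ {p} → p ∈ large → (Prime p × p ≤ n + n) × n < p
  large-prime i = let (j , l) = ∈-filter⁻ D {xs = primesUpTo (n + n)} i in ∈-primesUpTo⁻ {n + n} j , l
  divides-binomial : ∀ {p} → p ∈ large → p ∣ (n + n) C n
  divides-binomial {p} i with large-prime i
  ... | (pp , p≤) , n<p with euclidsLemma ((n + n) C n) (n ! * n !) pp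
        (subst (p ∣_) (sym (proj₂ (central-binomial n))) (≤⇒∣! (≤-trans (s≤s z≤n) n<p) p≤))
  ...   | inj₁ x = x
  ...   | inj₂ y with euclidsLemma (n !) (n !) pp y
  ...     | inj₁ z = ⊥-elim (<-irrefl refl (<-≤-trans n<p (prime∣!⇒≤ pp n z)))
  ...     | inj₂ z = ⊥-elim (<-irrefl refl (<-≤-trans n<p (prime∣!⇒≤ pp n z)))
  split≤ : π (n + n) ≤ π n + length large
  split≤ = begin
    π (n + n)                     ≡⟨ length-filter-split D (primesUpTo (n + n)) ⟩
    length large + length small   ≡⟨ +-comm (length large) _ ⟩
    length small + length large   ≤⟨ +-monoˡ-≤ (length large) (unique-⊆⇒length≤ small (primesUpTo n)
                                       (Uniq.filter⁺ (¬? ∘ D) (unique-primesUpTo (n + n)))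
                                       (λ i → let (j , l) = ∈-filter⁻ (¬? ∘ D) {xs = primesUpTo (n + n)} i in
                                         ∈-primesUpTo⁺ (proj₁ (∈-primesUpTo⁻ {n + n} j)) (≮⇒≥ l))) ⟩
    π n + length large ∎

-- The non-prime `0` occupies one of the `n + 1` places in `upTo (suc n)`.
π≤n : ∀ n → 1 ≤ n → π n ≤ n
π≤n n 1≤n = s≤s⁻¹ (subst (suc (π n) ≤_) (length-upTo (suc n))
  (unique-⊆⇒length≤ (0 ∷ primesUpTo n) (upTo (suc n))
    (All.tabulate (λ i e → ¬prime[0] (subst Prime (sym e) (proj₁ (∈-primesUpTo⁻ {n} i)))) ∷ unique-primesUpTo n)
    (λ { (here refl) → ∈-upTo⁺ (s≤s z≤n) ; (there i) → ∈-upTo⁺ (s≤s (proj₂ (∈-primesUpTo⁻ {n} i))) })))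

-- Chebyshev's bound at powers of two. In the step with `n = 2 ^ j`, `n ^ r ≤ 2 ^ (n + n)` bounds
-- `j * r` by `n + n` for the new primes, and the additional copy of `π (n + n)` is bounded
-- trivially.
j*π[2^j]≤ : ∀ j → j * π (2 ^ j) ≤ 4 * 2 ^ j
j*π[2^j]≤ zero = z≤n
j*π[2^j]≤ (suc j) with π-double (2 ^ j)
... | r , l , h = begin
  suc j * π (2 * n)                 ≡⟨ cong (λ x → suc j * π x) 2n≡ ⟩
  π (n + n) + j * π (n + n)         ≤⟨ +-mono-≤ (π≤n (n + n) (≤-trans 1≤n (m≤m+n n n))) (*-monoʳ-≤ j l) ⟩
  n + n + j * (π n + r)             ≡⟨ cong (n + n +_) (*-distribˡ-+ j (π n) r) ⟩
  n + n + (j * π n + j * r)         ≤⟨ +-monoʳ-≤ (n + n) (+-mono-≤ (j*π[2^j]≤ j) jr≤) ⟩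
  n + n + (4 * n + (n + n))         ≡⟨ lem n ⟩
  4 * (2 * n) ∎
  where
  open ≤-Reasoning
  n = 2 ^ j
  1≤n = m^n>0 2 j
  2n≡ : 2 * n ≡ n + n
  2n≡ = cong (n +_) (+-identityʳ n)
  jr≤ : j * r ≤ n + n
  jr≤ = ^-cancelˡ-≤ {2} ≤-refl (subst (_≤ 2 ^ (n + n)) (^-*-assoc 2 j r) h)
  lem : ∀ n → n + n + (4 * n + (n + n)) ≡ 4 * (2 * n)
  lem = solve-∀

-- `n` is replaced by the power of two `2 ^ suc j`, which is at most `2 * n`. The logarithm is taken
-- of `suc n` so that the strict bound reads `2 ^ j ≤ n`.
n^πn≤ : ∀ n → 2 ≤ n → n ^ π n ≤ 2 ^ (8 * n)
n^πn≤ n 2≤n with floorLog 2 (suc n) ≤-refl (s≤s 2≤n)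
... | j , _ , l , h = begin
  n ^ π n                                   ≤⟨ ^-monoˡ-≤ (π n) n≤ ⟩
  (2 ^ suc j) ^ π n                         ≡⟨ ^-*-assoc 2 (suc j) (π n) ⟩
  2 ^ (suc j * π n)                         ≤⟨ ^-monoʳ-≤ 2 (*-monoʳ-≤ (suc j) (π-mono n≤)) ⟩
  2 ^ (suc j * π (2 ^ suc j))               ≤⟨ ^-monoʳ-≤ 2 (j*π[2^j]≤ (suc j)) ⟩
  2 ^ (4 * (2 * 2 ^ j))                     ≡⟨ cong (2 ^_) (sym (*-assoc 4 2 (2 ^ j))) ⟩
  2 ^ (8 * 2 ^ j)                           ≤⟨ ^-monoʳ-≤ 2 (*-monoʳ-≤ 8 (s≤s⁻¹ l)) ⟩
  2 ^ (8 * n) ∎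
  where
  open ≤-Reasoning
  n≤ : n ≤ 2 ^ suc j
  n≤ = ≤-trans (n≤1+n n) h

prime-divisor : ∀ n → 2 ≤ n → ∃ λ p → Prime p × p ∣ n
prime-divisor n 2≤n = go factors factorsPrime isFactorisation
  where
  open PrimeFactorisation (factorise n {{>-nonZero (<⇒≤ 2≤n)}})
  go : ∀ fs → All Prime fs → n ≡ product fs → ∃ λ p → Prime p × p ∣ n
  go [] _ e = ⊥-elim (<-irrefl (sym e) 2≤n)
  go (p ∷ fs) (pp ∷ _) e = p , pp , subst (p ∣_) (sym e) (m∣m*n (product fs))

-- Euclid's argument with `n ! + 1`.
prime> : ∀ n → ∃ λ p → Prime p × n < p
prime> n with prime-divisor (suc (n !)) (s≤s (1≤n! n))
... | p , pp , d = p , pp , ≰⇒> λ p≤n → 1∤ (∣m+n∣m⇒∣n (subst (p ∣_) (+-comm 1 (n !)) d)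
      (≤⇒∣! (>-nonZero⁻¹ p {{prime⇒nonZero pp}}) p≤n))
  where
  1∤ : ¬ (p ∣ 1)
  1∤ e with ∣1⇒≡1 e | prime⇒nonTrivial pp
  ... | refl | ()

π-unbounded : ∀ m → ∃ λ n → m ≤ π n
π-unbounded zero = 0 , z≤n
π-unbounded (suc m) with π-unbounded m
... | n , h with prime> n
... | p , pp , n<p = p , ≤-trans (s≤s h) (unique-⊆⇒length≤ (p ∷ primesUpTo n) (primesUpTo p)
      (All.tabulate (λ i e → <-irrefl (sym e) (≤-<-trans (proj₂ (∈-primesUpTo⁻ {n} i)) n<p)) ∷ unique-primesUpTo n)
      (λ { (here refl) → ∈-primesUpTo⁺ pp ≤-refl
         ; (there i) → let (pq , l) = ∈-primesUpTo⁻ {n} i in ∈-primesUpTo⁺ pq (≤-trans l (<⇒≤ n<p)) }))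

-- Smooth numbers and sumsets

lookup-fromList-∈ : ∀ (xs : List ℕ) i → lookup (fromList xs) i ∈ xs
lookup-fromList-∈ (x ∷ xs) zero = here refl
lookup-fromList-∈ (x ∷ xs) (suc i) = there (lookup-fromList-∈ xs i)

lookup-fromList-injective : ∀ (xs : List ℕ) → Unique xs → ∀ i j → lookup (fromList xs) i ≡ lookup (fromList xs) j → i ≡ j
lookup-fromList-injective (x ∷ xs) u zero zero e = refl
lookup-fromList-injective (x ∷ xs) (x∉ ∷ u) zero (suc j) e = ⊥-elim (All.lookup x∉ (lookup-fromList-∈ xs j) e)
lookup-fromList-injective (x ∷ xs) (x∉ ∷ u) (suc i) zero e = ⊥-elim (All.lookup x∉ (lookup-fromList-∈ xs i) (sym e))
lookup-fromList-injective (x ∷ xs) (x∉ ∷ u) (suc i) (suc j) e = cong suc (lookup-fromList-injective xs u i j e)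

ev-bump : ∀ {p} (xs : List ℕ) → p ∈ xs → ∀ e → ∃ λ e′ → ev (fromList xs) e′ ≡ p * ev (fromList xs) e
ev-bump (x ∷ xs) (here refl) (e ∷ es) = suc e ∷ es , *-assoc x (x ^ e) _
ev-bump {p} (x ∷ xs) (there i) (e ∷ es) with ev-bump xs i es
... | es′ , eq = e ∷ es′ , trans (cong (x ^ e *_) eq) (lem (x ^ e) p _)
  where
  lem : ∀ a b c → a * (b * c) ≡ b * (a * c)
  lem = solve-∀

ev-product : ∀ (xs fs : List ℕ) → All (_∈ xs) fs → ∃ λ e → ev (fromList xs) e ≡ product fs
ev-product xs [] [] = replicate _ 0 , ev-zero (fromList xs)
ev-product xs (f ∷ fs) (i ∷ is) with ev-product xs fs is
... | e , eq with ev-bump xs i e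
... | e′ , eq′ = e′ , trans eq′ (cong (f *_) eq)

≤foldr-⊔ : ∀ {p} b (xs : List ℕ) → p ∈ xs → p ≤ foldr _⊔_ b xs
≤foldr-⊔ b (x ∷ xs) (here refl) = m≤m⊔n x _
≤foldr-⊔ b (x ∷ xs) (there i) = ≤-trans (≤foldr-⊔ b xs i) (m≤n⊔m x _)

foldr-⊔≤ : ∀ {b c} (xs : List ℕ) → b ≤ c → All (_≤ c) xs → foldr _⊔_ b xs ≤ c
foldr-⊔≤ [] h [] = h
foldr-⊔≤ (x ∷ xs) h (l ∷ ls) = ⊔-lub l (foldr-⊔≤ xs h ls)

prime-divisor≤P⁺ : ∀ {p n} → 1 ≤ n → Prime p → p ∣ n → p ≤ P⁺ n
prime-divisor≤P⁺ {p} {n} 1≤n pp d = ≤foldr-⊔ 1 _ (∈-filter⁺ (λ p → prime? p ×-dec (p ∣? n))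
  (∈-upTo⁺ (s≤s (∣⇒≤ {{>-nonZero 1≤n}} d))) (pp , d))

P⁺≤ : ∀ {n Y} → 1 ≤ Y → (∀ {p} → Prime p → p ∣ n → p ≤ Y) → P⁺ n ≤ Y
P⁺≤ {n} 1≤Y h = foldr-⊔≤ _ 1≤Y (All.tabulate λ i →
  let (_ , pp , d) = ∈-filter⁻ (λ p → prime? p ×-dec (p ∣? n)) {xs = upTo (suc n)} i in h pp d)

∈-𝒮⁺ : ∀ {n N Y} → 1 ≤ n → n ≤ N → P⁺ n ≤ Y → n ∈ 𝒮 N Y
∈-𝒮⁺ {suc n} {N} {Y} _ n≤N h = ∈-filter⁺ (λ n → P⁺ n ≤? Y) (∈-map⁺ suc (∈-upTo⁺ n≤N)) h

∈-𝒮⁻ : ∀ {n N Y} → n ∈ 𝒮 N Y → 1 ≤ n × n ≤ N × P⁺ n ≤ Y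
∈-𝒮⁻ {n} {N} {Y} i with ∈-filter⁻ (λ n → P⁺ n ≤? Y) {xs = map suc (upTo N)} i
... | j , h with ∈-map⁻ suc j
... | m , m∈ , refl = s≤s z≤n , ∈-upTo⁻ m∈ , h

unique-𝒮 : ∀ N Y → Unique (𝒮 N Y)
unique-𝒮 N Y = Uniq.filter⁺ (λ n → P⁺ n ≤? Y) (Uniq.map⁺ (λ { refl → refl }) (Uniq.upTo⁺ N))

map-preimage : {A B : Set} (f : A → B) (ys : List B) → All (λ y → ∃ λ x → f x ≡ y) ys → ∃ λ xs → map f xs ≡ ys
map-preimage f [] [] = [] , refl
map-preimage f (y ∷ ys) ((x , e) ∷ ps) with map-preimage f ys ps
... | xs , eq = x ∷ xs , cong₂ _∷_ e eq

module SmoothSetting (N Y : ℕ) (2≤Y : 2 ≤ Y) where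

  private
    ps : Vec ℕ (π Y)
    ps = fromList (primesUpTo Y)

    prime : ∀ i → Prime (lookup ps i)
    prime i = proj₁ (∈-primesUpTo⁻ {Y} (lookup-fromList-∈ (primesUpTo Y) i))

    ps≤Y : ∀ i → lookup ps i ≤ Y
    ps≤Y i = proj₂ (∈-primesUpTo⁻ {Y} (lookup-fromList-∈ (primesUpTo Y) i))

    distinct : ∀ i j → lookup ps i ≡ lookup ps j → i ≡ j
    distinct = lookup-fromList-injective (primesUpTo Y) (unique-primesUpTo Y)

    decompose : ∀ {n} → n ∈ 𝒮 N Y → ∃ λ e → ev ps e ≡ n
    decompose {n} i with ∈-𝒮⁻ {n} {N} {Y} i
    ... | 1≤n , _ , h = let (e , eq) = ev-product (primesUpTo Y) factors (All.tabulate member) in e , trans eq (sym isFactorisation)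
      where
      open PrimeFactorisation (factorise n {{>-nonZero 1≤n}})
      divides-product : ∀ {p} fs → p ∈ fs → p ∣ product fs
      divides-product (f ∷ fs) (here refl) = m∣m*n (product fs)
      divides-product (f ∷ fs) (there j) = ∣n⇒∣m*n f (divides-product fs j)
      member : ∀ {p} → p ∈ factors → p ∈ primesUpTo Y
      member j = let pp = All.lookup factorsPrime j in
        ∈-primesUpTo⁺ pp (≤-trans (prime-divisor≤P⁺ 1≤n pp (subst (_ ∣_) (sym isFactorisation) (divides-product factors j))) h)

    listing : ∃ λ as → map (ev ps) as ≡ 𝒮 N Y
    listing = map-preimage (ev ps) (𝒮 N Y) (All.tabulate decompose)

    as = proj₁ listing

    complete : ∀ e → ev ps e ≤ N → ev ps e ∈ 𝒮 N Y
    complete e l = ∈-𝒮⁺ {ev ps e} {N} {Y} (1≤ev ps e (λ i → >-nonZero⁻¹ _ {{prime⇒nonZero (prime i)}})) l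
      (P⁺≤ (<⇒≤ 2≤Y) λ {p} pp d → ≮⇒≥ λ Y<p → prime∤ev pp ps e prime (λ i eq → <-irrefl (sym eq) (≤-<-trans (ps≤Y i) Y<p) ) d)

    ∈-as : ∀ e → ev ps e ∈ 𝒮 N Y → e ∈ as
    ∈-as e i = case ∈-map⁻ (ev ps) (subst (ev ps e ∈_) (sym (proj₂ listing)) i) of λ
      { (e′ , j , eq) → subst (_∈ as) (sym (ev-injective ps prime distinct e e′ eq)) j }

  setting : Setting (π Y)
  setting = record
    { ps = ps ; prime = prime ; distinct = distinct ; Y = Y ; N = N ; ps≤Y = ps≤Y ; 2≤Y = 2≤Y
    ; 1≤k = ∈-length (∈-primesUpTo⁺ prime[2] 2≤Y)
    ; as = as
    ; as-unique = Uniq.map⁻ (subst Unique (sym (proj₂ listing)) (unique-𝒮 N Y))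
    ; as-sound = All.tabulate λ {e} i → proj₁ (proj₂ (∈-𝒮⁻ {ev ps e} {N} {Y} (subst (ev ps e ∈_) (proj₂ listing) (∈-map⁺ (ev ps) i))))
    ; as-complete = λ e l → ∈-as e (complete e l)
    }

  ψ≡Ψ : Smooth.ψ setting ≡ Ψ N Y
  ψ≡Ψ = trans (sym (length-map (ev ps) as)) (cong length (proj₂ listing))

  exponents : ∀ {n} → n ∈ 𝒮 N Y → ∃ λ e → Smooth.E setting e ≡ n × Smooth.InA setting e
  exponents {n} i = let (e , eq) = decompose i in e , eq , subst (_≤ N) (sym eq) (proj₁ (proj₂ (∈-𝒮⁻ {n} {N} {Y} i)))

-- The sumset and its ambiguous pairs.

module SumsetCount (A : List ℕ) (unique-A : Unique A) where

  S = sumset A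

  pairs = cartesianProduct A A

  total : ℕ × ℕ → ℕ
  total (x , y) = x + y

  ∈-sumset⁺ : ∀ {x y} → x ∈ A → y ∈ A → x + y ∈ S
  ∈-sumset⁺ i j = ∈-deduplicate⁺ _≟_ (∈-cartesianProductWith⁺ _+_ i j)

  ∈-sumset⁻ : ∀ {n} → n ∈ S → ∃₂ λ x y → x ∈ A × y ∈ A × n ≡ x + y
  ∈-sumset⁻ i = let (x , y , x∈ , y∈ , e) = ∈-cartesianProductWith⁻ _+_ A A (∈-deduplicate⁻ _≟_ _ i) in x , y , x∈ , y∈ , e

  Ambiguous : ℕ × ℕ → Set
  Ambiguous (x , y) = Any.Any (λ { (z , w) → x + y ≡ z + w × x ≢ z × y ≢ z }) pairs

  ambiguous? : ∀ z → Dec (Ambiguous z)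
  ambiguous? (x , y) = Any.any? (λ { (z , w) → (x + y ≟ z + w) ×-dec (¬? (x ≟ z) ×-dec ¬? (y ≟ z)) }) pairs

  ambiguous = filter ambiguous? pairs

  _≟²_ = ×-≟ _≟_ _≟_

  length-pairs : length pairs ≡ length A * length A
  length-pairs = length-cartesianProductWith _,_ A A

  -- An unambiguous pair is determined by its sum up to order, and the bit `x ≤ᵇ y` fixes the order.
  pairs≤ : length A * length A ≤ 2 * length S + length ambiguous
  pairs≤ = begin
    length A * length A                 ≡⟨ length-pairs ⟨
    length pairs                        ≡⟨ length-filter-split ambiguous? pairs ⟩
    length ambiguous + length unambiguous ≤⟨ +-monoʳ-≤ (length ambiguous) unambiguous≤ ⟩
    length ambiguous + 2 * length S     ≡⟨ +-comm (length ambiguous) _ ⟩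
    2 * length S + length ambiguous ∎
    where
    open ≤-Reasoning
    unambiguous = filter (¬? ∘ ambiguous?) pairs
    bools = true ∷ false ∷ []
    unambiguous⁻ : ∀ {z} → z ∈ unambiguous → z ∈ pairs × ¬ Ambiguous z
    unambiguous⁻ = ∈-filter⁻ (¬? ∘ ambiguous?) {xs = pairs}
    inj : ∀ {x y x′ y′} → x′ ∈ A → y′ ∈ A → ¬ Ambiguous (x , y) → x + y ≡ x′ + y′ → (x ≤ᵇ y) ≡ (x′ ≤ᵇ y′) → (x , y) ≡ (x′ , y′)
    inj {x} {y} {x′} {y′} i j na e s with x ≟ x′ | y ≟ x′
    ... | yes refl | _ = cong (x ,_) (+-cancelˡ-≡ x y y′ e)
    ... | no p | no q = ⊥-elim (na (Any.map (λ { refl → e , p , q }) (∈-cartesianProduct⁺ i j)))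
    ... | no p | yes refl with +-cancelˡ-≡ y x y′ (trans (+-comm y x) e)
    ...   | refl with ≤ᵇ-cases x y | ≤ᵇ-cases y x
    ...     | inj₁ (_ , l) | inj₁ (_ , l′) = ⊥-elim (p (≤-antisym l l′))
    ...     | inj₂ (_ , l) | inj₂ (_ , l′) = ⊥-elim (p (≤-antisym l′ l))
    ...     | inj₁ (a , _) | inj₂ (b , _) = case trans (sym a) (trans s b) of λ ()
    ...     | inj₂ (a , _) | inj₁ (b , _) = case trans (sym a) (trans s b) of λ ()
    unambiguous≤ : length unambiguous ≤ 2 * length S
    unambiguous≤ = subst₂ _≤_ (*-identityʳ _) (trans (length-cartesianProductWith _,_ S bools) (*-comm (length S) 2))
      (bound (atMost-inj (×-≟ _≟_ Boolₚ._≟_)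
        (λ { (n , s) (x , y) → (x , y) ∈ unambiguous × n ≡ x + y × s ≡ (x ≤ᵇ y) })
        (atMost-⊆ (cartesianProduct S bools) id)
        (λ { {x , y} i → let (x∈ , y∈) = ∈-cartesianProduct⁻ A A (proj₁ (unambiguous⁻ i)) in
             (x + y , (x ≤ᵇ y)) , ∈-cartesianProduct⁺ (∈-sumset⁺ x∈ y∈) (∈-bools _) , i , refl , refl })
        (λ { {_} {x , y} {x′ , y′} (i , e , s) (i′ , e′ , s′) →
             let (x∈ , y∈) = ∈-cartesianProduct⁻ A A (proj₁ (unambiguous⁻ i′)) in
             inj x∈ y∈ (proj₂ (unambiguous⁻ i)) (trans (sym e) e′) (trans (sym s) s′) }))
        unambiguous (Uniq.filter⁺ (¬? ∘ ambiguous?) (Uniq.cartesianProduct⁺ unique-A unique-A)) (All.tabulate id))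

  -- Each sum has a representation with `x ≤ y`. Its reversal is a second pair outside `ordered`,
  -- unless `x = y`; the diagonal accounts for the additional `length A`.
  sums≤ : 2 * length S ≤ length A * length A + length A
  sums≤ = begin
    2 * length S                                     ≡⟨ cong (length S +_) (+-identityʳ _) ⟩
    length S + length S                              ≤⟨ +-mono-≤ S≤ordered S≤reversed ⟩
    length ordered + (length reversed + length A)    ≡⟨ +-assoc (length ordered) _ _ ⟨
    length ordered + length reversed + length A      ≡⟨ cong (_+ length A) (length-filter-split ordered? pairs) ⟨
    length pairs + length A                          ≡⟨ cong (_+ length A) length-pairs ⟩
    length A * length A + length A ∎
    where
    open ≤-Reasoning
    ordered? : ∀ (z : ℕ × ℕ) → Dec (proj₁ z ≤ proj₂ z)
    ordered? z = proj₁ z ≤? proj₂ z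
    ordered = filter ordered? pairs
    reversed = filter (¬? ∘ ordered?) pairs
    unique-S : Unique S
    unique-S = deduplicate-! _≟_ _
    sorted : ∀ {n} → n ∈ S → ∃₂ λ x y → x ∈ A × y ∈ A × x ≤ y × n ≡ x + y
    sorted i with ∈-sumset⁻ i
    ... | x , y , x∈ , y∈ , e with ≤-total x y
    ...   | inj₁ l = x , y , x∈ , y∈ , l , e
    ...   | inj₂ l = y , x , y∈ , x∈ , l , trans e (+-comm x y)
    S≤ordered : length S ≤ length ordered
    S≤ordered = subst (_≤ length ordered) (*-identityʳ _) (bound
      (atMost-inj _≟²_ (λ z n → n ≡ total z) (atMost-⊆ ordered id)
        (λ i → let (x , y , x∈ , y∈ , l , e) = sorted i in (x , y) , ∈-filter⁺ ordered? (∈-cartesianProduct⁺ x∈ y∈) l , e)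
        (λ { refl refl → refl })) S unique-S (All.tabulate id))
    S≤reversed : length S ≤ length reversed + length A
    S≤reversed = subst (_≤ length reversed + length A) (*-identityʳ _) (bound
      (atMost-mono {P = λ n → (∃ λ z → z ∈ reversed × n ≡ total z) ⊎ (∃ λ x → x ∈ A × n ≡ x + x)} ≤-refl ≤-refl cases
        (atMost-⊎ (atMost-inj _≟²_ (λ z n → n ≡ total z) (atMost-⊆ reversed id) id (λ { refl refl → refl }))
                  (atMost-inj _≟_ (λ x n → n ≡ x + x) (atMost-⊆ A id) id (λ { refl refl → refl }))))
      S unique-S (All.tabulate id))
      where
      cases : ∀ {n} → n ∈ S → (∃ λ z → z ∈ reversed × n ≡ total z) ⊎ (∃ λ x → x ∈ A × n ≡ x + x)
      cases i with sorted i
      ... | x , y , x∈ , y∈ , l , e with x ≟ y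
      ...   | yes refl = inj₂ (x , x∈ , e)
      ...   | no ne = inj₁ ((y , x) , ∈-filter⁺ (¬? ∘ ordered?) (∈-cartesianProduct⁺ y∈ x∈) (<⇒≱ (≤∧≢⇒< l ne)) , trans e (+-comm x y))

∣-∣≤⊔ : ∀ {a b c d} → a ≤ b + c → b ≤ a + d → ∣ a - b ∣ ≤ c ⊔ d
∣-∣≤⊔ {a} {b} {c} {d} h h′ with ≤-total a b
... | inj₁ l = ≤-trans (≤-reflexive (m≤n⇒∣m-n∣≡n∸m l)) (≤-trans (m≤n+o⇒m∸n≤o b a h′) (m≤n⊔m c d))
... | inj₂ l = ≤-trans (≤-reflexive (m≤n⇒∣n-m∣≡n∸m l)) (≤-trans (m≤n+o⇒m∸n≤o a b h) (m≤m⊔n c d))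

-- The error is at most the larger of the diagonal `p` and the number `a` of ambiguous pairs. Both
-- are small against `p * p`: the first because `p ≥ w`, the second because `a` is at most
-- `8 * (p * p) / w`.
nearly-half-square : ∀ {h p a w} → 2 * h ≤ p * p + p → p * p ≤ 2 * h + a → a * w ≤ 8 * (p * p) → w ≤ p →
  ∀ m → 8 * suc m < w → suc m * ∣ 2 * h - p * p ∣ < p * p
nearly-half-square {h} {p} {a} {w} upper lower few w≤p m large = begin-strict
  suc m * ∣ 2 * h - p * p ∣     ≤⟨ *-monoʳ-≤ (suc m) (∣-∣≤⊔ upper lower) ⟩
  suc m * (p ⊔ a)               ≡⟨ *-distribˡ-⊔ (suc m) p a ⟩
  suc m * p ⊔ suc m * a         <⟨ ⊔-lub (*-monoˡ-< p {{>-nonZero 0<p}} m<p) (ambiguous< a few) ⟩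
  p * p ∎
  where
  open ≤-Reasoning
  m<p : suc m < p
  m<p = <-≤-trans (≤-<-trans (m≤m+n (suc m) _) large) w≤p
  0<p : 0 < p
  0<p = ≤-<-trans z≤n m<p
  lem : ∀ m a → 8 * (m * a) ≡ a * (8 * m)
  lem = solve-∀
  ambiguous< : ∀ a → a * w ≤ 8 * (p * p) → suc m * a < p * p
  -- For `a = 0`, multiplication by `a` would lose the strict inequality.
  ambiguous< zero _ = subst (_< p * p) (sym (*-zeroʳ (suc m))) (*-mono-< 0<p 0<p)
  ambiguous< a@(suc _) few = *-cancelˡ-< 8 _ _ (begin-strict
    8 * (suc m * a)     ≡⟨ lem (suc m) a ⟩
    a * (8 * suc m)     <⟨ *-monoʳ-< a large ⟩
    a * w               ≤⟨ few ⟩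
    8 * (p * p) ∎)

-- Choice of the scale and uniformity in `Y`.

module Main (κ : ℕ) (κ-large : 6291456 ≤ κ) where

  1≤κ : 1 ≤ κ
  1≤κ = ≤-trans (≤ᵇ⇒≤ 1 6291456 _) κ-large

  3≤κ : 3 ≤ κ
  3≤κ = ≤-trans (≤ᵇ⇒≤ 3 6291456 _) κ-large

  V : ℕ → ℕ
  V z = Scales.V (κ * z)

  module _ (N Y : ℕ) (2≤Y : 2 ≤ Y) (z : ℕ) (1≤z : 1 ≤ z) (big : Y ^ (4 * π Y * (4 * V z)) < N) where

    open SmoothSetting N Y 2≤Y
    open Smooth setting
    open SumsetCount (𝒮 N Y) (unique-𝒮 N Y)

    private
      1≤t : 1 ≤ κ * z
      1≤t = *-mono-≤ 1≤κ 1≤z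
      module B = Cases setting (κ * z) 1≤t

    atMost-ambiguous : AtMost ((κ * z) ^ π Y) (8 * (κ ^ π Y * (ψ * ψ))) (λ p → p ∈ ambiguous)
    atMost-ambiguous = atMost-inj _≟ᵖ_ (λ { (a , b) (x , y) → x ≡ E a × y ≡ E b }) (B.atMost-bad big κ κ-large)
      (λ { {x , y} i → lift i }) (λ { (refl , refl) (refl , refl) → refl })
      where
      lift : ∀ {x y} → (x , y) ∈ ambiguous → ∃ λ ab → B.Bad ab × x ≡ E (proj₁ ab) × y ≡ E (proj₂ ab)
      lift {x} {y} i with ∈-filter⁻ ambiguous? {xs = pairs} i
      ... | i′ , amb with ∈-cartesianProduct⁻ (𝒮 N Y) (𝒮 N Y) i′ | find amb
      ... | x∈ , y∈ | (v , w) , j , e , x≢v , y≢v with ∈-cartesianProduct⁻ (𝒮 N Y) (𝒮 N Y) j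
      ... | v∈ , w∈ with exponents x∈ | exponents y∈ | exponents v∈ | exponents w∈
      ... | a , refl , pa | b , refl , pb | c , refl , pc | d , refl , pd =
        (a , b) , (c , d , pa , pb , pc , pd , e , x≢v ∘ cong E , y≢v ∘ cong E) , refl , refl

    -- The scale is `t = κ * z`: its factor `κ` cancels the losses of all cases, and `z` is the net
    -- saving per prime.
    ambiguous-few : length ambiguous * z ^ π Y ≤ 8 * (ψ * ψ)
    ambiguous-few = *-cancelˡ-≤ (κ ^ π Y) {{>-nonZero (m^n>0 κ {{>-nonZero 1≤κ}} (π Y))}} (begin
      κ ^ π Y * (length ambiguous * z ^ π Y)   ≡⟨ lem (κ ^ π Y) (length ambiguous) (z ^ π Y) ⟩
      length ambiguous * (κ ^ π Y * z ^ π Y)   ≡⟨ cong (length ambiguous *_) (^-distribʳ-* (π Y) κ z) ⟨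
      length ambiguous * (κ * z) ^ π Y       ≤⟨ bound atMost-ambiguous ambiguous (Uniq.filter⁺ ambiguous? (Uniq.cartesianProduct⁺ (unique-𝒮 N Y) (unique-𝒮 N Y))) (All.tabulate id) ⟩
      8 * (κ ^ π Y * (ψ * ψ))                ≡⟨ lem′ (κ ^ π Y) (ψ * ψ) ⟩
      κ ^ π Y * (8 * (ψ * ψ)) ∎)
      where
      open ≤-Reasoning
      lem : ∀ a b c → a * (b * c) ≡ b * (a * c)
      lem = solve-∀
      lem′ : ∀ a b → 8 * (a * b) ≡ a * (8 * b)
      lem′ = solve-∀

    -- Makes the diagonal negligible: it supplies the hypothesis `w ≤ p` of `nearly-half-square`.
    z^k≤ψ : z ^ π Y ≤ ψ
    z^k≤ψ = *-cancelˡ-≤ (3 ^ π Y) {{m^n≢0 3 (π Y)}} (begin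
      3 ^ π Y * z ^ π Y      ≤⟨ *-monoˡ-≤ (z ^ π Y) (^-monoˡ-≤ (π Y) 3≤κ) ⟩
      κ ^ π Y * z ^ π Y      ≡⟨ ^-distribʳ-* (π Y) κ z ⟨
      (κ * z) ^ π Y        ≤⟨ ^-monoˡ-≤ (π Y) (B.t≤V big) ⟩
      V z ^ π Y            ≤⟨ B.V^k≤ψ3^k big ⟩
      ψ * 3 ^ π Y          ≡⟨ *-comm ψ _ ⟩
      3 ^ π Y * ψ ∎)
      where open ≤-Reasoning

    conclusion : ∀ m → 8 * suc m < z ^ π Y → suc m * ∣ 2 * sumsetSize N Y - Ψ N Y * Ψ N Y ∣ < Ψ N Y * Ψ N Y
    conclusion m large = nearly-half-square {sumsetSize N Y} {Ψ N Y} {length ambiguous} sums≤ pairs≤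
      (subst (λ p → length ambiguous * z ^ π Y ≤ 8 * (p * p)) ψ≡Ψ ambiguous-few) (subst (z ^ π Y ≤_) ψ≡Ψ z^k≤ψ) m large

  8*suc<2^ : ∀ m → 8 * suc m < 2 ^ (4 + m)
  8*suc<2^ m = begin-strict
    8 * suc m          ≤⟨ *-monoʳ-≤ 8 (m<B^m 2 m ≤-refl) ⟩
    8 * 2 ^ m          <⟨ *-monoˡ-< (2 ^ m) {{m^n≢0 2 m}} (≤ᵇ⇒≤ 9 16 _) ⟩
    16 * 2 ^ m         ≡⟨ ^-distribˡ-+-* 2 4 m ⟨
    2 ^ (4 + m) ∎
    where open ≤-Reasoning

  -- `128 = 8 * 16`: the exponent `8 * Y` of the bound for `Y ^ π Y`, times the `16 * V 2` demanded
  -- by the scale `z = 2`. The final hypothesis has `suc K`, which yields the strict inequality.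
  K : ℕ
  K = 128 * V 2

  many-primes : ∀ N Y → 2 ≤ Y → 2 ^ (suc K * Y) ≤ N → Y ^ (4 * π Y * (4 * V 2)) < N
  many-primes N Y 2≤Y h = begin-strict
    Y ^ (4 * π Y * (4 * V 2))      ≡⟨ cong (Y ^_) (lem (π Y) (V 2)) ⟩
    Y ^ (π Y * (16 * V 2))         ≡⟨ ^-*-assoc Y (π Y) (16 * V 2) ⟨
    (Y ^ π Y) ^ (16 * V 2)         ≤⟨ ^-monoˡ-≤ (16 * V 2) (n^πn≤ Y 2≤Y) ⟩
    (2 ^ (8 * Y)) ^ (16 * V 2)     ≡⟨ ^-*-assoc 2 (8 * Y) (16 * V 2) ⟩
    2 ^ (8 * Y * (16 * V 2))       ≡⟨ cong (2 ^_) (lem′ Y (V 2)) ⟩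
    2 ^ (128 * V 2 * Y)            <⟨ ^-monoʳ-< 2 ≤-refl (m<n+m (128 * V 2 * Y) (<⇒≤ 2≤Y)) ⟩
    2 ^ (suc K * Y)                ≤⟨ h ⟩
    N ∎
    where
    open ≤-Reasoning
    lem : ∀ a v → 4 * a * (4 * v) ≡ a * (16 * v)
    lem = solve-∀
    lem′ : ∀ y v → 8 * y * (16 * v) ≡ 128 * v * y
    lem′ = solve-∀

  few-primes : ∀ m Y₀ N Y z → 2 ≤ Y → Y ≤ Y₀ → π Y ≤ m → Y₀ ^ (4 * m * (4 * V z)) < N → Y ^ (4 * π Y * (4 * V z)) < N
  few-primes m Y₀ N Y z 2≤Y Y≤ π≤ h = ≤-<-trans (≤-trans (^-monoˡ-≤ (4 * π Y * (4 * V z)) Y≤)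
    (^-monoʳ-≤ Y₀ {{>-nonZero (≤-trans (<⇒≤ 2≤Y) Y≤)}} (*-monoˡ-≤ (4 * V z) (*-monoʳ-≤ 4 π≤)))) h

  -- With many primes up to Y, the scale z = 2 suffices; otherwise Y is bounded, and z may depend on m.
  main : Σ ℕ λ k → (m : ℕ) → Σ ℕ λ N₀ → (N Y : ℕ) → N₀ ≤ N → 2 ≤ Y → 2 ^ (suc k * Y) ≤ N →
    suc m * ∣ 2 * sumsetSize N Y - Ψ N Y * Ψ N Y ∣ < Ψ N Y * Ψ N Y
  main = K , λ m →
    let (Y₀ , Y₀-large) = π-unbounded (4 + m)
        z = suc (8 * suc m)
    in suc (Y₀ ^ (4 * (4 + m) * (4 * V z))) , λ N Y N₀≤N 2≤Y h → case 4 + m ≤? π Y of λ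
      { (yes l) → conclusion N Y 2≤Y 2 (s≤s z≤n) (many-primes N Y 2≤Y h) m
          (<-≤-trans (8*suc<2^ m) (^-monoʳ-≤ 2 l))
      ; (no l) → conclusion N Y 2≤Y z (s≤s z≤n)
          (few-primes (4 + m) Y₀ N Y z 2≤Y
            (<⇒≤ (≰⇒> λ Y₀≤Y → l (≤-trans Y₀-large (π-mono Y₀≤Y)))) (<⇒≤ (≰⇒> l)) N₀≤N) m
          -- The prime `2` is at most `Y`, so `z ^ π Y` is at least `z = 8 * suc m + 1`.
          (≤-trans (≤-reflexive (sym (*-identityʳ z)))
            (^-monoʳ-≤ z (∈-length (∈-primesUpTo⁺ {Y} prime[2] 2≤Y)))) }

-- With `N` and `Y` the integer parts of `x` and `y`, the condition `2 ^ (suc k * Y) ≤ N` follows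
-- from `y ≤ c log x` for `c = 1 / ((k + 1) log 2)`. The relative error is bounded by `1 / (m + 1)`
-- for every `m`.
theorem3 : Σ ℕ λ k → (m : ℕ) → Σ ℕ λ N₀ → (N Y : ℕ) → N₀ ≤ N → 2 ≤ Y → 2 ^ (suc k * Y) ≤ N →
    suc m * ∣ 2 * sumsetSize N Y - Ψ N Y * Ψ N Y ∣ < Ψ N Y * Ψ N Y
theorem3 = Main.main 6291456 ≤-refl
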